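{- Let $n\ge2$, let $A,B_1,\ldots,B_n,C_1,\ldots,C_n\in\widehat{\mathbb F_q}$ and $x_1,\ldots,x_n\in\mathbb F_q$. Let $k,l\in\{1,\ldots,n\}$ with $k\neq l$, $x_l\ne0$ and $x_k\neq 0$. Then $$\begin{aligned}F_A^{(n)}&\left[A;B_1,\ldots,B_n;C_1,\ldots,C_n\mid x_1,\ldots,x_n\right]\\&=\frac{B_kC_k(-1)}{q}\,\overline{B_k}C_k(x_k-1)\,\overline{C_k}(x_k)\,\overline{A}(-x_l)\,C_l(-1)\;F_A^{(n-1)}\left[A;(B_i')_{i\ne k};(C_i)_{i\neq k}\mid (y_i)_{i\neq k}\right]\\&\quad+\frac{B_kC_k(-1)}{q}\sum_{t_k\in\mathbb F_q,\ t_k\ne x_k^{ -1}}B_k(t_k)\,\overline{B_k}C_k(1-t_k)\,\overline{A}(1-x_kt_k)\;F_A^{(n-1)}\left[A;(B_i)_{i\ne k};(C_i)_{i\ne k}\,\Big|\,\Big(\frac{x_i}{1-x_kt_k}\Big)_{i\ne k}\right],\end{aligned}$$ where $B_l'=\overline{B_l}C_l$ and $B_i'=B_i$ for $i\ne k,l$, while $y_l=1$ and $y_i=-x_i/x_l$ for $i\neq k,l$, and all lists $(\cdot)_{i\ne k}$ are indexed by $i\in\{1,\ldots,n\}\setminus\{k\}$ in increasing order.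
   Context: Let $p$ be an odd prime, $q=p^r$ with $r\ge1$, and $\mathbb F_q$ the field with $q$ elements. $\widehat{\mathbb F_q}$ is the group of multiplicative characters $\chi:\mathbb F_q^\times\to\mathbb C^\times$, each extended to $\mathbb F_q$ by $\chi(0)=0$ (including the trivial character $\epsilon$, so $\epsilon(0)=0$ and $\epsilon(x)=1$ for $x\neq0$). $\overline{\chi}$ is the inverse of $\chi$, and products of characters are pointwise, e.g. $\overline{B}C(x)=\overline{B}(x)C(x)$. For each $m\ge1$ the finite field Lauricella series is (the subscript $A$ in $F_A^{(m)}$ is part of the name) $$F_A^{(m)}\left[A;B_1,\ldots,B_m;C_1,\ldots,C_m\mid x_1,\ldots,x_m\right]=\sum_{t_1,\ldots,t_m\in\mathbb F_q}\left(\prod_{i=1}^m\epsilon(x_i)\frac{B_iC_i(-1)}{q}B_i(t_i)\overline{B_i}C_i(1-t_i)\right)\overline{A}(1-x_1t_1-\cdots-x_mt_m).$$ -}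

module Defs where

open import Algebra.Bundles using (AbelianGroup; CommutativeRing)
open import Algebra.Morphism.Bundles using (GroupHomomorphism)
open import Algebra.Properties.Monoid.Sum using (sum)
import Algebra.Properties.AbelianGroup as AbelianGroupProperties
import Algebra.Properties.CommutativeSemigroup as CommutativeSemigroupProperties
open import Data.Bool.Base using (if_then_else_)
open import Data.Fin.Base using (Fin)
open import Data.Fin.Properties using (nonZeroIndex; inj⇒≟)
import Data.Integer.Base as ℤ
open import Data.Nat.Base as ℕ using (ℕ; zero; suc; NonZero)
import Data.Nat.Properties as ℕ
open import Data.Product.Base using (∃; _×_; _,_; proj₁; proj₂)
open import Data.Rational.Base as ℚ using (ℚ; 0ℚ; 1ℚ; ½; ∣_∣; Positive)
import Data.Rational.Properties as ℚ
open import Data.Rational.Solver using (module +-*-Solver)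
open import Data.Vec.Functional using (Vector; []; _∷_)
open import Function.Base using (_∘_)
open import Function.Bundles using (Inverse)
open import Function.Properties.Inverse using (Inverse⇒Injection)
import Function.Construct.Symmetry as Symmetry
open import Level using (Level; 0ℓ; _⊔_) renaming (suc to lsuc)
open import Relation.Binary.Definitions using (Decidable)
open import Relation.Binary.PropositionalEquality as ≡
  using (_≡_; refl; cong; sym; subst)
import Relation.Binary.Reasoning.Setoid as ≈-Reasoning
open import Relation.Nullary using (does; yes; no; ¬_)

private
  variable
    c ℓ : Level

-- Reals as rational Cauchy sequences carrying a modulus, with equality modulo
-- null sequences.

record ℝ : Set where
  no-eta-equality
  field
    approx : ℕ → ℚ
    cauchy : ∀ ε → 0ℚ ℚ.< ε → ∃ λ N → ∀ m n → N ℕ.≤ m → N ℕ.≤ n →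
             ∣ approx m ℚ.- approx n ∣ ℚ.< ε

open ℝ

infix 4 _≈ᴿ_

_≈ᴿ_ : ℝ → ℝ → Set
x ≈ᴿ y = ∀ ε → 0ℚ ℚ.< ε → ∃ λ N → ∀ n → N ℕ.≤ n →
         ∣ approx x n ℚ.- approx y n ∣ ℚ.< ε

-- Rational families h indexed by I tending to 0 along tails T N.  The tails
-- N ≤ n give null sequences and the tails N ≤ m, N ≤ n give the Cauchy
-- condition, so the same estimates serve both.
private
  module Vanishing {I : Set} (T : ℕ → I → Set)
    (antitone : ∀ {M N i} → M ℕ.≤ N → T N i → T M i) where

    Null : (I → ℚ) → Set
    Null h = ∀ ε → 0ℚ ℚ.< ε → ∃ λ N → ∀ i → T N i → ∣ h i ∣ ℚ.< ε

    Bounded : (I → ℚ) → Set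
    Bounded h = ∃ λ M → Positive M × ∃ λ N → ∀ i → T N i → ∣ h i ∣ ℚ.≤ M

    null-resp : ∀ {f g} → (∀ i → f i ≡ g i) → Null f → Null g
    null-resp f≡g nf ε ε>0 with nf ε ε>0
    ... | N , p = N , λ i t → subst (λ a → ∣ a ∣ ℚ.< ε) (f≡g i) (p i t)

    null-0 : Null (λ _ → 0ℚ)
    null-0 ε ε>0 = 0 , λ _ _ → ε>0

    null-neg : ∀ {f} → Null f → Null (λ i → ℚ.- f i)
    null-neg {f} nf ε ε>0 with nf ε ε>0
    ... | N , p = N , λ i t → subst (ℚ._< ε) (sym (ℚ.∣-p∣≡∣p∣ (f i))) (p i t)

    half+half : ∀ a → ½ ℚ.* a ℚ.+ ½ ℚ.* a ≡ a
    half+half a = ≡.trans (sym (ℚ.*-distribʳ-+ a ½ ½)) (ℚ.*-identityˡ a)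

    half-pos : ∀ {ε} → 0ℚ ℚ.< ε → 0ℚ ℚ.< ½ ℚ.* ε
    half-pos ε>0 = ℚ.*-monoʳ-<-pos ½ ε>0

    null-+ : ∀ {f g} → Null f → Null g → Null (λ i → f i ℚ.+ g i)
    null-+ {f} {g} nf ng ε ε>0
      with nf (½ ℚ.* ε) (half-pos ε>0) | ng (½ ℚ.* ε) (half-pos ε>0)
    ... | M , p | N , q = M ℕ.⊔ N , λ i t →
      ℚ.≤-<-trans (ℚ.∣p+q∣≤∣p∣+∣q∣ (f i) (g i))
        (subst (∣ f i ∣ ℚ.+ ∣ g i ∣ ℚ.<_) (half+half ε)
          (ℚ.+-mono-< (p i (antitone (ℕ.m≤m⊔n M N) t))
                      (q i (antitone (ℕ.m≤n⊔m M N) t))))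

    null-* : ∀ {f g} → Bounded f → Null g → Null (λ i → f i ℚ.* g i)
    null-* {f} {g} (M , M>0 , K , b) ng ε ε>0 = result
      where
      instance
        pos : Positive M
        pos = M>0
        nonz : ℚ.NonZero M
        nonz = ℚ.pos⇒nonZero M
        pos⁻¹ : Positive (ℚ.1/ M)
        pos⁻¹ = ℚ.1/pos⇒pos M
      δ : ℚ
      δ = ℚ.1/ M ℚ.* ε
      δ>0 : 0ℚ ℚ.< δ
      δ>0 = subst (ℚ._< δ) (ℚ.*-zeroʳ (ℚ.1/ M)) (ℚ.*-monoʳ-<-pos (ℚ.1/ M) ε>0)
      Mδ≡ε : M ℚ.* δ ≡ ε
      Mδ≡ε = ≡.trans (sym (ℚ.*-assoc M (ℚ.1/ M) ε))
               (≡.trans (cong (ℚ._* ε) (ℚ.*-inverseʳ M)) (ℚ.*-identityˡ ε))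
      result : ∃ λ N → ∀ i → T N i → ∣ f i ℚ.* g i ∣ ℚ.< ε
      result with ng δ δ>0
      ... | N , p = K ℕ.⊔ N , λ i t →
        subst (ℚ._< ε) (sym (ℚ.∣p*q∣≡∣p∣*∣q∣ (f i) (g i)))
          (ℚ.≤-<-trans
            (ℚ.*-monoʳ-≤-nonNeg ∣ g i ∣ {{ℚ.∣-∣-nonNeg (g i)}}
              (b i (antitone (ℕ.m≤m⊔n K N) t)))
            (subst (M ℚ.* ∣ g i ∣ ℚ.<_) Mδ≡ε
              (ℚ.*-monoʳ-<-pos M (p i (antitone (ℕ.m≤n⊔m K N) t)))))

  module V₁ = Vanishing ℕ._≤_ ℕ.≤-trans
  module V₂ = Vanishing {ℕ × ℕ} (λ N i → N ℕ.≤ proj₁ i × N ℕ.≤ proj₂ i)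
    (λ M≤N t → ℕ.≤-trans M≤N (proj₁ t) , ℕ.≤-trans M≤N (proj₂ t))

  differences : (ℕ → ℚ) → ℕ × ℕ → ℚ
  differences f (m , n) = f m ℚ.- f n

  toNull : ∀ x → V₂.Null (differences (approx x))
  toNull x ε ε>0 with cauchy x ε ε>0
  ... | N , p = N , λ { (m , n) (N≤m , N≤n) → p m n N≤m N≤n }

  fromNull : ∀ f → V₂.Null (differences f) →
             ∀ ε → 0ℚ ℚ.< ε → ∃ λ N → ∀ m n → N ℕ.≤ m → N ℕ.≤ n →
             ∣ f m ℚ.- f n ∣ ℚ.< ε
  fromNull f nf ε ε>0 =
    proj₁ (nf ε ε>0) , λ m n N≤m N≤n → proj₂ (nf ε ε>0) (m , n) (N≤m , N≤n)

  bounded : ∀ x → V₁.Bounded (approx x)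
  bounded x with cauchy x 1ℚ (ℚ.positive⁻¹ 1ℚ)
  ... | N , p = ∣ a ∣ ℚ.+ 1ℚ , M>0 , N , λ n N≤n →
    subst (λ z → ∣ z ∣ ℚ.≤ ∣ a ∣ ℚ.+ 1ℚ) (split (approx x n))
      (ℚ.≤-trans (ℚ.∣p+q∣≤∣p∣+∣q∣ a (approx x n ℚ.- a))
        (ℚ.+-monoʳ-≤ ∣ a ∣ (ℚ.<⇒≤ (p n N N≤n ℕ.≤-refl))))
    where
    a : ℚ
    a = approx x N
    M>0 : Positive (∣ a ∣ ℚ.+ 1ℚ)
    M>0 = subst Positive (ℚ.+-comm 1ℚ ∣ a ∣)
            (ℚ.pos+nonNeg⇒pos 1ℚ ∣ a ∣ {{ℚ.∣-∣-nonNeg a}})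
    open +-*-Solver
    split : ∀ b → a ℚ.+ (b ℚ.- a) ≡ b
    split b = solve 2 (λ a b → a :+ (b :- a) := b) refl a b

  bounded-proj : (π : ℕ × ℕ → ℕ) →
                 (∀ {N i} → N ℕ.≤ proj₁ i × N ℕ.≤ proj₂ i → N ℕ.≤ π i) →
                 ∀ x → V₂.Bounded (approx x ∘ π)
  bounded-proj π tail x =
    let M , M>0 , N , b = bounded x in M , M>0 , N , λ i t → b (π i) (tail t)

  module Identities where
    open +-*-Solver

    sub-+ : ∀ a b c d → (a ℚ.- b) ℚ.+ (c ℚ.- d) ≡ (a ℚ.+ c) ℚ.- (b ℚ.+ d)
    sub-+ = solve 4 (λ a b c d → (a :- b) :+ (c :- d) := (a :+ c) :- (b :+ d)) refl

    sub-neg : ∀ a b → ℚ.- (a ℚ.- b) ≡ ℚ.- a ℚ.- (ℚ.- b)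
    sub-neg = solve 2 (λ a b → :- (a :- b) := :- a :- (:- b)) refl

    sub-* : ∀ a b c d → a ℚ.* (c ℚ.- d) ℚ.+ d ℚ.* (a ℚ.- b) ≡ a ℚ.* c ℚ.- b ℚ.* d
    sub-* = solve 4 (λ a b c d → a :* (c :- d) :+ d :* (a :- b) := a :* c :- b :* d) refl

    sub-swap : ∀ a b → ℚ.- (a ℚ.- b) ≡ b ℚ.- a
    sub-swap = solve 2 (λ a b → :- (a :- b) := b :- a) refl

    sub-trans : ∀ a b c → (a ℚ.- b) ℚ.+ (b ℚ.- c) ≡ a ℚ.- c
    sub-trans = solve 3 (λ a b c → (a :- b) :+ (b :- c) := a :- c) refl

  open Identities

infixl 6 _+ᴿ_
infixl 7 _*ᴿ_
infix  8 -ᴿ_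

fromℚ : ℚ → ℝ
approx (fromℚ a) _ = a
cauchy (fromℚ a) = fromNull (λ _ → a)
  (V₂.null-resp (λ _ → sym (ℚ.+-inverseʳ a)) V₂.null-0)

_+ᴿ_ : ℝ → ℝ → ℝ
approx (x +ᴿ y) n = approx x n ℚ.+ approx y n
cauchy (x +ᴿ y) = fromNull (λ n → approx x n ℚ.+ approx y n) (V₂.null-resp
  (λ (m , n) → sub-+ (approx x m) (approx x n) (approx y m) (approx y n))
  (V₂.null-+ (toNull x) (toNull y)))

-ᴿ_ : ℝ → ℝ
approx (-ᴿ x) n = ℚ.- approx x n
cauchy (-ᴿ x) = fromNull (λ n → ℚ.- approx x n) (V₂.null-resp
  (λ (m , n) → sub-neg (approx x m) (approx x n)) (V₂.null-neg (toNull x)))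

_*ᴿ_ : ℝ → ℝ → ℝ
approx (x *ᴿ y) n = approx x n ℚ.* approx y n
cauchy (x *ᴿ y) = fromNull (λ n → approx x n ℚ.* approx y n) (V₂.null-resp
  (λ (m , n) → sub-* (approx x m) (approx x n) (approx y m) (approx y n))
  (V₂.null-+ (V₂.null-* (bounded-proj proj₁ proj₁ x) (toNull y))
             (V₂.null-* (bounded-proj proj₂ proj₂ y) (toNull x))))

private
  pointwise : ∀ x y → (∀ n → approx x n ≡ approx y n) → x ≈ᴿ y
  pointwise x y x≡y = V₁.null-resp
    (λ n → sym (≡.trans (cong (ℚ._- approx y n) (x≡y n)) (ℚ.+-inverseʳ (approx y n))))
    V₁.null-0

  ≈ᴿ-refl : ∀ x → x ≈ᴿ x
  ≈ᴿ-refl x = pointwise x x λ _ → refl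

  ≈ᴿ-sym : ∀ x y → x ≈ᴿ y → y ≈ᴿ x
  ≈ᴿ-sym x y x≈y =
    V₁.null-resp (λ n → sub-swap (approx x n) (approx y n)) (V₁.null-neg x≈y)

  ≈ᴿ-trans : ∀ x y z → x ≈ᴿ y → y ≈ᴿ z → x ≈ᴿ z
  ≈ᴿ-trans x y z x≈y y≈z = V₁.null-resp
    (λ n → sub-trans (approx x n) (approx y n) (approx z n)) (V₁.null-+ x≈y y≈z)

  +ᴿ-cong : ∀ x y u v → x ≈ᴿ y → u ≈ᴿ v → x +ᴿ u ≈ᴿ y +ᴿ v
  +ᴿ-cong x y u v x≈y u≈v = V₁.null-resp
    (λ n → sub-+ (approx x n) (approx y n) (approx u n) (approx v n))
    (V₁.null-+ x≈y u≈v)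

  -ᴿ-cong : ∀ x y → x ≈ᴿ y → -ᴿ x ≈ᴿ -ᴿ y
  -ᴿ-cong x y x≈y =
    V₁.null-resp (λ n → sub-neg (approx x n) (approx y n)) (V₁.null-neg x≈y)

  *ᴿ-cong : ∀ x y u v → x ≈ᴿ y → u ≈ᴿ v → x *ᴿ u ≈ᴿ y *ᴿ v
  *ᴿ-cong x y u v x≈y u≈v = V₁.null-resp
    (λ n → sub-* (approx x n) (approx y n) (approx u n) (approx v n))
    (V₁.null-+ (V₁.null-* (bounded x) u≈v) (V₁.null-* (bounded v) x≈y))

record ℂ : Set where
  no-eta-equality
  field
    re im : ℝ

open ℂ

infix  4 _≈ᶜ_
infixr 4 _,ᶜ_
infixl 6 _+ᶜ_
infixl 7 _*ᶜ_
infix  8 -ᶜ_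

record _≈ᶜ_ (z w : ℂ) : Set where
  constructor _,ᶜ_
  field
    re≈ : re z ≈ᴿ re w
    im≈ : im z ≈ᴿ im w

_+ᶜ_ : ℂ → ℂ → ℂ
re (z +ᶜ w) = re z +ᴿ re w
im (z +ᶜ w) = im z +ᴿ im w

_*ᶜ_ : ℂ → ℂ → ℂ
re (z *ᶜ w) = re z *ᴿ re w +ᴿ -ᴿ (im z *ᴿ im w)
im (z *ᶜ w) = re z *ᴿ im w +ᴿ im z *ᴿ re w

-ᶜ_ : ℂ → ℂ
re (-ᶜ z) = -ᴿ re z
im (-ᶜ z) = -ᴿ im z

ℚ→ℂ : ℚ → ℂ
re (ℚ→ℂ a) = fromℚ a
im (ℚ→ℂ a) = fromℚ 0ℚ

0ᶜ 1ᶜ : ℂ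
0ᶜ = ℚ→ℂ 0ℚ
1ᶜ = ℚ→ℂ 1ℚ

private
  pointwiseᶜ : ∀ z w → (∀ n → approx (re z) n ≡ approx (re w) n) →
               (∀ n → approx (im z) n ≡ approx (im w) n) → z ≈ᶜ w
  pointwiseᶜ z w p q = pointwise (re z) (re w) p ,ᶜ pointwise (im z) (im w) q

  *ᶜ-cong : ∀ {z w u v} → z ≈ᶜ w → u ≈ᶜ v → z *ᶜ u ≈ᶜ w *ᶜ v
  *ᶜ-cong {z} {w} {u} {v} (p ,ᶜ q) (r ,ᶜ s) =
    +ᴿ-cong (re z *ᴿ re u) (re w *ᴿ re v) (-ᴿ (im z *ᴿ im u)) (-ᴿ (im w *ᴿ im v))
      (*ᴿ-cong (re z) (re w) (re u) (re v) p r)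
      (-ᴿ-cong (im z *ᴿ im u) (im w *ᴿ im v)
        (*ᴿ-cong (im z) (im w) (im u) (im v) q s)) ,ᶜ
    +ᴿ-cong (re z *ᴿ im u) (re w *ᴿ im v) (im z *ᴿ re u) (im w *ᴿ re v)
      (*ᴿ-cong (re z) (re w) (im u) (im v) p s)
      (*ᴿ-cong (im z) (im w) (re u) (re v) q r)

  *ᶜ-comm : ∀ z w → z *ᶜ w ≈ᶜ w *ᶜ z
  *ᶜ-comm z w = pointwiseᶜ (z *ᶜ w) (w *ᶜ z)
    (λ n → solve 4 (λ a b c d → a :* c :- b :* d := c :* a :- d :* b) refl
      (approx (re z) n) (approx (im z) n) (approx (re w) n) (approx (im w) n))
    (λ n → solve 4 (λ a b c d → a :* d :+ b :* c := c :* b :+ d :* a) refl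
      (approx (re z) n) (approx (im z) n) (approx (re w) n) (approx (im w) n))
    where open +-*-Solver

  *ᶜ-assoc : ∀ z w u → (z *ᶜ w) *ᶜ u ≈ᶜ z *ᶜ (w *ᶜ u)
  *ᶜ-assoc z w u = pointwiseᶜ ((z *ᶜ w) *ᶜ u) (z *ᶜ (w *ᶜ u))
    (λ n → solve 6 (λ a b c d e f →
        (a :* c :- b :* d) :* e :- (a :* d :+ b :* c) :* f
        := a :* (c :* e :- d :* f) :- b :* (c :* f :+ d :* e)) refl
      (approx (re z) n) (approx (im z) n) (approx (re w) n) (approx (im w) n)
      (approx (re u) n) (approx (im u) n))
    (λ n → solve 6 (λ a b c d e f →
        (a :* c :- b :* d) :* f :+ (a :* d :+ b :* c) :* e
        := a :* (c :* f :+ d :* e) :+ b :* (c :* e :- d :* f)) refl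
      (approx (re z) n) (approx (im z) n) (approx (re w) n) (approx (im w) n)
      (approx (re u) n) (approx (im u) n))
    where open +-*-Solver

  *ᶜ-identityˡ : ∀ z → 1ᶜ *ᶜ z ≈ᶜ z
  *ᶜ-identityˡ z = pointwiseᶜ (1ᶜ *ᶜ z) z
    (λ n → solve 2 (λ a b → con 1ℚ :* a :- con 0ℚ :* b := a) refl
      (approx (re z) n) (approx (im z) n))
    (λ n → solve 2 (λ a b → con 1ℚ :* b :+ con 0ℚ :* a := b) refl
      (approx (re z) n) (approx (im z) n))
    where open +-*-Solver

  *ᶜ-distribˡ : ∀ z w u → z *ᶜ (w +ᶜ u) ≈ᶜ z *ᶜ w +ᶜ z *ᶜ u
  *ᶜ-distribˡ z w u = pointwiseᶜ (z *ᶜ (w +ᶜ u)) (z *ᶜ w +ᶜ z *ᶜ u)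
    (λ n → solve 6 (λ a b c d e f →
        a :* (c :+ e) :- b :* (d :+ f) := (a :* c :- b :* d) :+ (a :* e :- b :* f)) refl
      (approx (re z) n) (approx (im z) n) (approx (re w) n) (approx (im w) n)
      (approx (re u) n) (approx (im u) n))
    (λ n → solve 6 (λ a b c d e f →
        a :* (d :+ f) :+ b :* (c :+ e) := (a :* d :+ b :* c) :+ (a :* f :+ b :* e)) refl
      (approx (re z) n) (approx (im z) n) (approx (re w) n) (approx (im w) n)
      (approx (re u) n) (approx (im u) n))
    where open +-*-Solver

  ≈ᶜ-trans : ∀ {z w u} → z ≈ᶜ w → w ≈ᶜ u → z ≈ᶜ u
  ≈ᶜ-trans {z} {w} {u} (p ,ᶜ q) (r ,ᶜ s) =
    ≈ᴿ-trans (re z) (re w) (re u) p r ,ᶜ ≈ᴿ-trans (im z) (im w) (im u) q s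

  +ᶜ-cong : ∀ {z w u v} → z ≈ᶜ w → u ≈ᶜ v → z +ᶜ u ≈ᶜ w +ᶜ v
  +ᶜ-cong {z} {w} {u} {v} (p ,ᶜ q) (r ,ᶜ s) =
    +ᴿ-cong (re z) (re w) (re u) (re v) p r ,ᶜ +ᴿ-cong (im z) (im w) (im u) (im v) q s

  +ᶜ-comm : ∀ z w → z +ᶜ w ≈ᶜ w +ᶜ z
  +ᶜ-comm z w = pointwiseᶜ (z +ᶜ w) (w +ᶜ z)
    (λ n → ℚ.+-comm (approx (re z) n) (approx (re w) n))
    (λ n → ℚ.+-comm (approx (im z) n) (approx (im w) n))

  *ᶜ-distribʳ : ∀ z w u → (w +ᶜ u) *ᶜ z ≈ᶜ w *ᶜ z +ᶜ u *ᶜ z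
  *ᶜ-distribʳ z w u =
    ≈ᶜ-trans (*ᶜ-comm (w +ᶜ u) z)
      (≈ᶜ-trans (*ᶜ-distribˡ z w u) (+ᶜ-cong (*ᶜ-comm z w) (*ᶜ-comm z u)))

ℂ-commutativeRing : CommutativeRing 0ℓ 0ℓ
ℂ-commutativeRing = record
  { Carrier = ℂ ; _≈_ = _≈ᶜ_ ; _+_ = _+ᶜ_ ; _*_ = _*ᶜ_ ; -_ = -ᶜ_ ; 0# = 0ᶜ ; 1# = 1ᶜ
  ; isCommutativeRing = record
    { isRing = record
      { +-isAbelianGroup = record
        { isGroup = record
          { isMonoid = record
            { isSemigroup = record
              { isMagma = record
                { isEquivalence = record
                  { refl  = λ {z} → ≈ᴿ-refl (re z) ,ᶜ ≈ᴿ-refl (im z)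
                  ; sym   = λ {z} {w} (p ,ᶜ q) →
                      ≈ᴿ-sym (re z) (re w) p ,ᶜ ≈ᴿ-sym (im z) (im w) q
                  ; trans = ≈ᶜ-trans
                  }
                ; ∙-cong = +ᶜ-cong
                }
              ; assoc = λ z w u → pointwiseᶜ ((z +ᶜ w) +ᶜ u) (z +ᶜ (w +ᶜ u))
                  (λ n → ℚ.+-assoc (approx (re z) n) (approx (re w) n) (approx (re u) n))
                  (λ n → ℚ.+-assoc (approx (im z) n) (approx (im w) n) (approx (im u) n))
              }
            ; identity =
                (λ z → pointwiseᶜ (0ᶜ +ᶜ z) z
                  (λ n → ℚ.+-identityˡ (approx (re z) n)) (λ n → ℚ.+-identityˡ (approx (im z) n)))
              , (λ z → pointwiseᶜ (z +ᶜ 0ᶜ) z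
                  (λ n → ℚ.+-identityʳ (approx (re z) n)) (λ n → ℚ.+-identityʳ (approx (im z) n)))
            }
          ; inverse =
              (λ z → pointwiseᶜ (-ᶜ z +ᶜ z) 0ᶜ
                (λ n → ℚ.+-inverseˡ (approx (re z) n)) (λ n → ℚ.+-inverseˡ (approx (im z) n)))
            , (λ z → pointwiseᶜ (z +ᶜ -ᶜ z) 0ᶜ
                (λ n → ℚ.+-inverseʳ (approx (re z) n)) (λ n → ℚ.+-inverseʳ (approx (im z) n)))
          ; ⁻¹-cong = λ {z} {w} (p ,ᶜ q) →
              -ᴿ-cong (re z) (re w) p ,ᶜ -ᴿ-cong (im z) (im w) q
          }
        ; comm = +ᶜ-comm
        }
      ; *-cong = *ᶜ-cong
      ; *-assoc = *ᶜ-assoc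
      ; *-identity = *ᶜ-identityˡ , λ z →
          ≈ᶜ-trans (*ᶜ-comm z 1ᶜ) (*ᶜ-identityˡ z)
      ; distrib = *ᶜ-distribˡ , *ᶜ-distribʳ
      }
    ; *-comm = *ᶜ-comm
    }
  }

module _ (R : CommutativeRing c ℓ) where
  open CommutativeRing R

  record Unit : Set (c ⊔ ℓ) where
    constructor unit
    field
      val inv   : Carrier
      val*inv≈1 : val * inv ≈ 1#

  unitGroup : AbelianGroup (c ⊔ ℓ) ℓ
  unitGroup = record
    { Carrier = Unit
    ; _≈_ = λ u v → Unit.val u ≈ Unit.val v
    ; _∙_ = λ (unit a a′ p) (unit b b′ q) → unit (a * b) (a′ * b′)
              (trans (interchange a b a′ b′) (trans (*-cong p q) (*-identityˡ 1#)))
    ; ε   = unit 1# 1# (*-identityˡ 1#)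
    ; _⁻¹ = λ (unit a a′ p) → unit a′ a (trans (*-comm a′ a) p)
    ; isAbelianGroup = record
      { isGroup = record
        { isMonoid = record
          { isSemigroup = record
            { isMagma = record
              { isEquivalence = record { refl = refl′ ; sym = sym′ ; trans = trans }
              ; ∙-cong = *-cong
              }
            ; assoc = λ u v w → *-assoc _ _ _
            }
          ; identity = (λ u → *-identityˡ _) , (λ u → *-identityʳ _)
          }
        ; inverse = (λ u → trans (*-comm _ _) (Unit.val*inv≈1 u)) , Unit.val*inv≈1
        ; ⁻¹-cong = λ {u} {v} → inv-cong u v
        }
      ; comm = λ u v → *-comm _ _
      }
    }
    where
    open CommutativeSemigroupProperties *-commutativeSemigroup using (interchange)
    open CommutativeRing R using () renaming (refl to refl′; sym to sym′)
    inv-cong : ∀ u v → Unit.val u ≈ Unit.val v → Unit.inv u ≈ Unit.inv v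
    inv-cong (unit a a′ p) (unit b b′ q) a≈b = begin
      a′               ≈⟨ *-identityʳ a′ ⟨
      a′ * 1#          ≈⟨ *-congˡ q ⟨
      a′ * (b * b′)    ≈⟨ *-assoc a′ b b′ ⟨
      (a′ * b) * b′    ≈⟨ *-congʳ (*-congˡ a≈b) ⟨
      (a′ * a) * b′    ≈⟨ *-congʳ (trans (*-comm a′ a) p) ⟩
      1# * b′          ≈⟨ *-identityˡ b′ ⟩
      b′               ∎
      where open ≈-Reasoning setoid

record FiniteField (c ℓ : Level) (q : ℕ) : Set (lsuc (c ⊔ ℓ)) where
  field
    commutativeRing : CommutativeRing c ℓ
  open CommutativeRing commutativeRing public
  field
    1≉0         : ¬ (1# ≈ 0#)
    invertible  : ∀ x → ¬ (x ≈ 0#) → ∃ λ y → x * y ≈ 1#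
    enumeration : Inverse (≡.setoid (Fin q)) setoid

  infix 4 _≟_
  _≟_ : Decidable _≈_
  _≟_ = inj⇒≟ (Inverse⇒Injection (Symmetry.inverse enumeration))

  -- The value 0⁻¹ = 0 is junk.
  infix 9 _⁻¹
  _⁻¹ : Carrier → Carrier
  x ⁻¹ with x ≟ 0#
  ... | yes _  = 0#
  ... | no x≉0 = proj₁ (invertible x x≉0)

  infixl 7 _/_
  _/_ : Carrier → Carrier → Carrier
  x / y = x * y ⁻¹

  instance
    q-nonZero : NonZero q
    q-nonZero = nonZeroIndex (Inverse.from enumeration 0#)

module Lauricella {c ℓ q} (F : FiniteField c ℓ q) where
  open FiniteField F public

  F× : AbelianGroup (c ⊔ ℓ) ℓ
  F× = unitGroup commutativeRing

  ℂ× : AbelianGroup 0ℓ 0ℓ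
  ℂ× = unitGroup ℂ-commutativeRing

  private
    module F× = AbelianGroup F×
    module ℂ× = AbelianGroup ℂ×
    module ℂᴿ = CommutativeRing ℂ-commutativeRing

  Character : Set (c ⊔ ℓ)
  Character = GroupHomomorphism F×.rawGroup ℂ×.rawGroup

  open GroupHomomorphism using (⟦_⟧; ⟦⟧-cong; homo)

  private
    module ℂ×ᴾ = AbelianGroupProperties ℂ×

    character : (f : F×.Carrier → ℂ×.Carrier) →
                (∀ u v → u F×.≈ v → f u ℂ×.≈ f v) →
                (∀ u v → f (u F×.∙ v) ℂ×.≈ f u ℂ×.∙ f v) →
                Character
    character f f-cong f-∙ = record
      { ⟦_⟧ = f
      ; isGroupHomomorphism = record
        { isMonoidHomomorphism = record
          { isMagmaHomomorphism = record
            { isRelHomomorphism = record { cong = λ {u} {v} → f-cong u v }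
            ; homo = f-∙
            }
          ; ε-homo = f-ε
          }
        ; ⁻¹-homo = λ u → ℂ×ᴾ.inverseˡ-unique (f (u F×.⁻¹)) (f u)
            (ℂᴿ.trans (ℂᴿ.sym (f-∙ (u F×.⁻¹) u))
              (ℂᴿ.trans (f-cong (u F×.⁻¹ F×.∙ u) F×.ε (F×.inverseˡ u)) f-ε))
        }
      }
      where
      f-ε : f F×.ε ℂ×.≈ ℂ×.ε
      f-ε = ℂ×ᴾ.identityˡ-unique (f F×.ε) (f F×.ε)
        (ℂᴿ.trans (ℂᴿ.sym (f-∙ F×.ε F×.ε))
          (f-cong (F×.ε F×.∙ F×.ε) F×.ε (F×.identityˡ F×.ε)))

  infixl 7 _·_
  infix  10 _⁻

  ε : Character
  ε = character (λ _ → ℂ×.ε) (λ _ _ _ → ℂᴿ.refl) (λ _ _ → ℂᴿ.sym (ℂᴿ.*-identityˡ 1ᶜ))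

  _·_ : Character → Character → Character
  χ · ψ = character (λ u → ⟦ χ ⟧ u ℂ×.∙ ⟦ ψ ⟧ u)
    (λ u v u≈v → ℂᴿ.*-cong (⟦⟧-cong χ {u} {v} u≈v) (⟦⟧-cong ψ {u} {v} u≈v))
    (λ u v → ℂᴿ.trans (ℂᴿ.*-cong (homo χ u v) (homo ψ u v)) (interchange _ _ _ _))
    where open CommutativeSemigroupProperties ℂᴿ.*-commutativeSemigroup using (interchange)

  _⁻ : Character → Character
  χ ⁻ = character (λ u → ⟦ χ ⟧ u ℂ×.⁻¹)
    (λ u v u≈v → ℂ×.⁻¹-cong {⟦ χ ⟧ u} {⟦ χ ⟧ v} (⟦⟧-cong χ {u} {v} u≈v))
    (λ u v → ℂ×.⁻¹-cong {⟦ χ ⟧ (u F×.∙ v)} {⟦ χ ⟧ u ℂ×.∙ ⟦ χ ⟧ v} (homo χ u v))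

  -- χ extended to the whole field by χ(0) = 0.
  infix 9 _⟨_⟩
  _⟨_⟩ : Character → Carrier → ℂ
  χ ⟨ x ⟩ with x ≟ 0#
  ... | yes _  = 0ᶜ
  ... | no x≉0 = Unit.val (⟦ χ ⟧ (unit x _ (proj₂ (invertible x x≉0))))

  1/q : ℂ
  1/q = ℚ→ℂ (ℤ.1ℤ ℚ./ q)

  ∏ : ∀ {m} → Vector ℂ m → ℂ
  ∏ = sum ℂᴿ.*-monoid

  ∑F : (Carrier → ℂ) → ℂ
  ∑F f = sum ℂᴿ.+-monoid (f ∘ Inverse.to enumeration)

  ∑F≢ : Carrier → (Carrier → ℂ) → ℂ
  ∑F≢ a f = ∑F λ t → if does (t ≟ a) then 0ᶜ else f t

  ∑Fⁿ : ∀ m → (Vector Carrier m → ℂ) → ℂ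
  ∑Fⁿ zero    f = f []
  ∑Fⁿ (suc m) f = ∑F λ t → ∑Fⁿ m λ ts → f (t ∷ ts)

  Fᴬ : ∀ m → Character → (B C : Vector Character m) → Vector Carrier m → ℂ
  Fᴬ m A B C x = ∑Fⁿ m λ t →
    ∏ (λ i → ε ⟨ x i ⟩ *ᶜ ((B i · C i) ⟨ - 1# ⟩ *ᶜ 1/q)
             *ᶜ B i ⟨ t i ⟩ *ᶜ (B i ⁻ · C i) ⟨ 1# - t i ⟩)
    *ᶜ A ⁻ ⟨ 1# - sum +-monoid (λ i → x i * t i) ⟩

{-# OPTIONS --safe #-}
module Submission where

-- Sum over t_k last.  With s = 1 − x_k t_k, the remaining sum is F_A^{(n−1)} in
-- which the argument of A ⁻ is s − Σ x_i t_i.  If s ≠ 0, multiplicativity pulls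
-- out A ⁻ (s) and rescales the x_i to x_i / s.  If s = 0, that is t_k = 1/x_k,
-- the substitution t_l ↦ 1 − t_l turns − Σ x_i t_i into
-- − x_l (1 − t_l − Σ_{i≠k,l} (− x_i / x_l) t_i) and exchanges B_l with B_l ⁻ · C_l.

open import Defs
open import Algebra.Bundles using (AbelianGroup; CommutativeMonoid; CommutativeRing)
open import Algebra.Morphism.Bundles using (GroupHomomorphism)
import Algebra.Properties.AbelianGroup as AbelianGroupProperties
import Algebra.Properties.CommutativeMonoid.Sum as CommutativeMonoidSum
import Algebra.Properties.Ring as RingProperties
import Algebra.Properties.Semiring.Sum as SemiringSum
import Algebra.Solver.CommutativeMonoid as CommutativeMonoidSolver
open import Data.Bool.Base using (if_then_else_)
open import Data.Empty using (⊥-elim)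
open import Data.Fin.Base using (Fin; zero; suc; punchIn; punchOut)
open import Data.Fin.Permutation using (Permutation; permutation)
open import Data.Fin.Properties using (punchInᵢ≢i; punchIn-injective; punchIn-punchOut)
open import Data.Nat.Base using (ℕ; zero; suc; _^_; _≤_)
open import Data.Nat.Divisibility using (_∣_)
open import Data.Nat.Primality using (Prime)
open import Data.Product.Base using (proj₂)
open import Data.Vec.Functional using (Vector; []; _∷_; removeAt; updateAt; insertAt)
open import Data.Vec.Functional.Properties
  using (insertAt-lookup; insertAt-punchIn; removeAt-punchOut; updateAt-updates; updateAt-minimal)
open import Function.Base using (_∘_)
open import Function.Bundles using (Inverse)
open import Level using (Level)
open import Relation.Binary.PropositionalEquality as ≡ using (_≡_; _≢_)
import Relation.Binary.Reasoning.Setoid as ≈-Reasoning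
open import Relation.Nullary using (Dec; ¬_; does; yes; no)

-- Sums in a commutative monoid and vectors with one entry changed.

module _ {a ℓ} (M : CommutativeMonoid a ℓ) where
  open CommutativeMonoid M
  open CommutativeMonoidSum M

  -- Splitting off index `i` on both sides lets the extra `d` move outside. It serves in three
  -- monoids: for the product of weights, for the linear form in the argument of `A ⁻`, and for
  -- taking one term out of a sum over the field.
  sum-cong-except : ∀ {n} {f g : Vector Carrier n} i {d} → f i ≈ d ∙ g i →
                    (∀ j → j ≢ i → f j ≈ g j) → sum f ≈ d ∙ sum g
  sum-cong-except {suc n} {f} {g} i {d} fᵢ≈d∙gᵢ f≈g = begin
    sum f                            ≈⟨ sum-remove {i = i} f ⟩
    f i ∙ sum (removeAt f i)         ≈⟨ ∙-cong fᵢ≈d∙gᵢ (sum-cong-≋ λ j → f≈g (punchIn i j) (punchInᵢ≢i i j)) ⟩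
    d ∙ g i ∙ sum (removeAt g i)     ≈⟨ assoc _ _ _ ⟩
    d ∙ (g i ∙ sum (removeAt g i))   ≈⟨ ∙-congˡ (sum-remove {i = i} g) ⟨
    d ∙ sum g                        ∎
    where open ≈-Reasoning setoid

module _ {a n} {A : Set a} (xs : Vector A (suc n)) {f : A → A} {k l : Fin (suc n)} (k≢l : k ≢ l) where

  removeAt-updateAt-updates : removeAt (updateAt xs l f) k (punchOut k≢l) ≡ f (xs l)
  removeAt-updateAt-updates =
    ≡.trans (removeAt-punchOut (updateAt xs l f) k≢l) (updateAt-updates l xs)

  -- After the removal of `k`, the old index `l` sits at `punchOut k≢l`; since `punchIn k` is
  -- injective, every other position comes from an index different from `l`.
  removeAt-updateAt-minimal : ∀ i → i ≢ punchOut k≢l → removeAt (updateAt xs l f) k i ≡ removeAt xs k i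
  removeAt-updateAt-minimal i i≢l = updateAt-minimal (punchIn k i) l xs λ k[i]≡l →
    i≢l (punchIn-injective k i (punchOut k≢l) (≡.trans k[i]≡l (≡.sym (punchIn-punchOut k≢l))))

module _ {c ℓ q} (F : FiniteField c ℓ q) where
  open Lauricella F hiding (zero)
  open GroupHomomorphism using (⟦_⟧; ⟦⟧-cong; homo; ε-homo)
  open RingProperties ring using (-‿distribˡ-*; x[y-z]≈xy-xz; [y-z]x≈yx-zx; -1*x≈-x)
  open AbelianGroupProperties +-abelianGroup using ()
    renaming ( ⁻¹-anti-homo‿- to -‿anti-homo; ⁻¹-involutive to -‿involutive
             ; ⁻¹-∙-comm to -‿+-comm; ε⁻¹≈ε to -0≈0 )

  private
    module ℂᴿ = CommutativeRing ℂ-commutativeRing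
    module F× = AbelianGroup F×
    module ℂ× = AbelianGroup ℂ×
    module Σᶜ = SemiringSum ℂᴿ.semiring
    module Πᶜ = CommutativeMonoidSum ℂᴿ.*-commutativeMonoid
    module Σᶠ = SemiringSum semiring
    module ≈ᶠ = ≈-Reasoning setoid
    module ≈ᶜ = ≈-Reasoning ℂᴿ.setoid
    module ℂ*-Solver = CommutativeMonoidSolver ℂᴿ.*-commutativeMonoid

  open Inverse enumeration using (to; from; strictlyInverseˡ; strictlyInverseʳ; from-cong)

  -- Inverses and signs in the finite field.

  ⁻¹-inverseʳ : ∀ {x} → ¬ (x ≈ 0#) → x * x ⁻¹ ≈ 1#
  ⁻¹-inverseʳ {x} x≉0 with x ≟ 0#
  ... | yes x≈0 = ⊥-elim (x≉0 x≈0)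
  ... | no x≉0′ = proj₂ (invertible x x≉0′)

  invertible⇒≉0 : ∀ {x y} → x * y ≈ 1# → ¬ (x ≈ 0#)
  invertible⇒≉0 {x} {y} xy≈1 x≈0 =
    1≉0 (trans (sym xy≈1) (trans (*-congʳ x≈0) (zeroˡ y)))

  ⁻¹-≉0 : ∀ {x} → ¬ (x ≈ 0#) → ¬ (x ⁻¹ ≈ 0#)
  ⁻¹-≉0 x≉0 = invertible⇒≉0 (trans (*-comm _ _) (⁻¹-inverseʳ x≉0))

  *-/-cancel : ∀ {x} y → ¬ (x ≈ 0#) → x * (y / x) ≈ y
  *-/-cancel {x} y x≉0 = begin
    x * (y * x ⁻¹)   ≈⟨ *-comm x _ ⟩
    y * x ⁻¹ * x     ≈⟨ *-assoc y _ x ⟩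
    y * (x ⁻¹ * x)   ≈⟨ *-congˡ (trans (*-comm _ x) (⁻¹-inverseʳ x≉0)) ⟩
    y * 1#           ≈⟨ *-identityʳ y ⟩
    y                ∎
    where open ≈ᶠ

  x-[x-y]≈y : ∀ x y → x - (x - y) ≈ y
  x-[x-y]≈y x y = begin
    x - (x - y)     ≈⟨ +-congˡ (-‿anti-homo x y) ⟩
    x + (y - x)     ≈⟨ +-assoc x y (- x) ⟨
    x + y - x       ≈⟨ +-congʳ (+-comm x y) ⟩
    y + x - x       ≈⟨ +-assoc y x (- x) ⟩
    y + (x - x)     ≈⟨ +-congˡ (-‿inverseʳ x) ⟩
    y + 0#          ≈⟨ +-identityʳ y ⟩
    y               ∎
    where open ≈ᶠ

  x-[y+z]≈[x-y]-z : ∀ x y z → x - (y + z) ≈ (x - y) - z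
  x-[y+z]≈[x-y]-z x y z =
    trans (+-congˡ (sym (-‿+-comm y z))) (sym (+-assoc x (- y) (- z)))

  -1*-1≈1 : - 1# * - 1# ≈ 1#
  -1*-1≈1 = trans (-1*x≈-x (- 1#)) (-‿involutive 1#)

  -1≉0 : ¬ (- 1# ≈ 0#)
  -1≉0 = invertible⇒≉0 -1*-1≈1

  -- Used in contrapositive form: away from the excluded point `x k ⁻¹`, division by `1# - x k * t`
  -- is genuine.
  1-x*y≈0⇒y≈x⁻¹ : ∀ {x y} → ¬ (x ≈ 0#) → 1# - x * y ≈ 0# → y ≈ x ⁻¹
  1-x*y≈0⇒y≈x⁻¹ {x} {y} x≉0 1-xy≈0 = begin
    y                            ≈⟨ *-/-cancel y x≉0 ⟨
    x * (y * x ⁻¹)               ≈⟨ *-assoc x y _ ⟨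
    x * y * x ⁻¹                 ≈⟨ *-congʳ (x-[x-y]≈y 1# (x * y)) ⟨
    (1# - (1# - x * y)) * x ⁻¹   ≈⟨ *-congʳ (+-congˡ (-‿cong 1-xy≈0)) ⟩
    (1# - 0#) * x ⁻¹             ≈⟨ *-congʳ (+-congˡ -0≈0) ⟩
    (1# + 0#) * x ⁻¹             ≈⟨ *-congʳ (+-identityʳ 1#) ⟩
    1# * x ⁻¹                    ≈⟨ *-identityˡ _ ⟩
    x ⁻¹                         ∎
    where open ≈ᶠ

  -- Values of extended characters.

  ⟨⟩-zero : ∀ χ {x} → x ≈ 0# → χ ⟨ x ⟩ ≈ᶜ 0ᶜ
  ⟨⟩-zero χ {x} x≈0 with x ≟ 0#
  ... | yes _  = ℂᴿ.refl
  ... | no x≉0 = ⊥-elim (x≉0 x≈0)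

  -- Equality of units looks only at `val`, so the inverse picked by `invertible` may be exchanged
  -- for the one stored in `u`.
  ⟨⟩-unit : ∀ χ (u : F×.Carrier) {x} → x ≈ Unit.val u → χ ⟨ x ⟩ ≈ᶜ Unit.val (⟦ χ ⟧ u)
  ⟨⟩-unit χ u {x} x≈u with x ≟ 0#
  ... | yes x≈0 = ⊥-elim (invertible⇒≉0 (Unit.val*inv≈1 u) (trans (sym x≈u) x≈0))
  ... | no x≉0  = ⟦⟧-cong χ {unit x _ _} {u} x≈u

  toUnit : ∀ {x} → ¬ (x ≈ 0#) → F×.Carrier
  toUnit {x} x≉0 = unit x (x ⁻¹) (⁻¹-inverseʳ x≉0)

  ⟨⟩-cong : ∀ χ {x y} → x ≈ y → χ ⟨ x ⟩ ≈ᶜ χ ⟨ y ⟩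
  ⟨⟩-cong χ {x} {y} x≈y with y ≟ 0#
  ... | yes y≈0 = ⟨⟩-zero χ (trans x≈y y≈0)
  ... | no y≉0  = ⟨⟩-unit χ (unit y _ _) x≈y

  ⟨⟩-* : ∀ χ x y → χ ⟨ x * y ⟩ ≈ᶜ χ ⟨ x ⟩ *ᶜ χ ⟨ y ⟩
  ⟨⟩-* χ x y = by-cases (x ≟ 0#) (y ≟ 0#)
    where
    open ≈ᶜ
    by-cases : Dec (x ≈ 0#) → Dec (y ≈ 0#) → χ ⟨ x * y ⟩ ≈ᶜ χ ⟨ x ⟩ *ᶜ χ ⟨ y ⟩
    by-cases (yes x≈0) _ = begin
      χ ⟨ x * y ⟩          ≈⟨ ⟨⟩-zero χ (trans (*-congʳ x≈0) (zeroˡ y)) ⟩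
      0ᶜ                   ≈⟨ ℂᴿ.zeroˡ _ ⟨
      0ᶜ *ᶜ χ ⟨ y ⟩        ≈⟨ ℂᴿ.*-congʳ (⟨⟩-zero χ x≈0) ⟨
      χ ⟨ x ⟩ *ᶜ χ ⟨ y ⟩   ∎
    by-cases (no _) (yes y≈0) = begin
      χ ⟨ x * y ⟩          ≈⟨ ⟨⟩-zero χ (trans (*-congˡ y≈0) (zeroʳ x)) ⟩
      0ᶜ                   ≈⟨ ℂᴿ.zeroʳ _ ⟨
      χ ⟨ x ⟩ *ᶜ 0ᶜ        ≈⟨ ℂᴿ.*-congˡ (⟨⟩-zero χ y≈0) ⟨
      χ ⟨ x ⟩ *ᶜ χ ⟨ y ⟩   ∎
    by-cases (no x≉0) (no y≉0) = begin
      χ ⟨ x * y ⟩                                  ≈⟨ ⟨⟩-unit χ (u F×.∙ v) refl ⟩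
      Unit.val (⟦ χ ⟧ (u F×.∙ v))                  ≈⟨ homo χ u v ⟩
      Unit.val (⟦ χ ⟧ u) *ᶜ Unit.val (⟦ χ ⟧ v)     ≈⟨ ℂᴿ.*-cong (⟨⟩-unit χ u refl) (⟨⟩-unit χ v refl) ⟨
      χ ⟨ x ⟩ *ᶜ χ ⟨ y ⟩                           ∎
      where
      u = toUnit x≉0
      v = toUnit y≉0

  ⟨1⟩≈1 : ∀ χ → χ ⟨ 1# ⟩ ≈ᶜ 1ᶜ
  ⟨1⟩≈1 χ = ℂᴿ.trans (⟨⟩-unit χ F×.ε refl) (ε-homo χ)

  ε⟨⟩≈1 : ∀ {x} → ¬ (x ≈ 0#) → ε ⟨ x ⟩ ≈ᶜ 1ᶜ
  ε⟨⟩≈1 x≉0 = ⟨⟩-unit ε (toUnit x≉0) refl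

  -- At 0 both sides vanish, so agreement on units suffices. For `D = χ · ψ` that agreement is
  -- reflexivity.
  ⟨⟩-product : ∀ {D} χ ψ →
    (∀ u → Unit.val (⟦ D ⟧ u) ≈ᶜ Unit.val (⟦ χ ⟧ u) *ᶜ Unit.val (⟦ ψ ⟧ u)) →
    ∀ x → D ⟨ x ⟩ ≈ᶜ χ ⟨ x ⟩ *ᶜ ψ ⟨ x ⟩
  ⟨⟩-product {D} χ ψ D≈χψ x = by-cases (x ≟ 0#)
    where
    open ≈ᶜ
    by-cases : Dec (x ≈ 0#) → D ⟨ x ⟩ ≈ᶜ χ ⟨ x ⟩ *ᶜ ψ ⟨ x ⟩
    by-cases (yes x≈0) = begin
      D ⟨ x ⟩              ≈⟨ ⟨⟩-zero D x≈0 ⟩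
      0ᶜ                   ≈⟨ ℂᴿ.zeroˡ _ ⟨
      0ᶜ *ᶜ ψ ⟨ x ⟩        ≈⟨ ℂᴿ.*-congʳ (⟨⟩-zero χ x≈0) ⟨
      χ ⟨ x ⟩ *ᶜ ψ ⟨ x ⟩   ∎
    by-cases (no x≉0) = begin
      D ⟨ x ⟩                                    ≈⟨ ⟨⟩-unit D u refl ⟩
      Unit.val (⟦ D ⟧ u)                         ≈⟨ D≈χψ u ⟩
      Unit.val (⟦ χ ⟧ u) *ᶜ Unit.val (⟦ ψ ⟧ u)   ≈⟨ ℂᴿ.*-cong (⟨⟩-unit χ u refl) (⟨⟩-unit ψ u refl) ⟨
      χ ⟨ x ⟩ *ᶜ ψ ⟨ x ⟩                         ∎
      where u = toUnit x≉0

  inv*val≈1 : (u : ℂ×.Carrier) → Unit.inv u *ᶜ Unit.val u ≈ᶜ 1ᶜ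
  inv*val≈1 u = ℂᴿ.trans (ℂᴿ.*-comm (Unit.inv u) (Unit.val u)) (Unit.val*inv≈1 u)

  ⁻-inverseˡ-⟨⟩ : ∀ χ {x} → ¬ (x ≈ 0#) → χ ⁻ ⟨ x ⟩ *ᶜ χ ⟨ x ⟩ ≈ᶜ 1ᶜ
  ⁻-inverseˡ-⟨⟩ χ {x} x≉0 = begin
    χ ⁻ ⟨ x ⟩ *ᶜ χ ⟨ x ⟩                       ≈⟨ ℂᴿ.*-cong (⟨⟩-unit (χ ⁻) u refl) (⟨⟩-unit χ u refl) ⟩
    Unit.inv (⟦ χ ⟧ u) *ᶜ Unit.val (⟦ χ ⟧ u)   ≈⟨ inv*val≈1 (⟦ χ ⟧ u) ⟩
    1ᶜ                                         ∎
    where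
    open ≈ᶜ
    u = toUnit x≉0

  -- D = B ⁻ · C, stated through values: comparing characters by conversion unfolds
  -- their homomorphism proofs, down to the moduli of the Cauchy sequences.
  IsRatio : (D B C : Character) → Set _
  IsRatio D B C = ∀ x → D ⟨ x ⟩ ≈ᶜ B ⁻ ⟨ x ⟩ *ᶜ C ⟨ x ⟩

  IsRatio-resp-≡ : ∀ {D D′ B B′ C C′} → D ≡ D′ → B ≡ B′ → C ≡ C′ →
                   IsRatio D′ B′ C′ → IsRatio D B C
  IsRatio-resp-≡ ≡.refl ≡.refl ≡.refl ratio = ratio

  -- For nonzero `x`, `D = B ⁻ · C` gives `D ⁻ · C = B` by cancellation; 0 is treated apart because
  -- there nothing can be cancelled. Hence reflecting a variable exchanges `B` and `D`
  -- symmetrically.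
  IsRatio-involutive : ∀ {D B C} → IsRatio D B C → IsRatio B D C
  IsRatio-involutive {D} {B} {C} D≈B⁻C x = by-cases (x ≟ 0#)
    where
    open ≈ᶜ
    open ℂ*-Solver using (solve; _⊕_; _⊜_)
    by-cases : Dec (x ≈ 0#) → B ⟨ x ⟩ ≈ᶜ D ⁻ ⟨ x ⟩ *ᶜ C ⟨ x ⟩
    by-cases (yes x≈0) = begin
      B ⟨ x ⟩                  ≈⟨ ⟨⟩-zero B x≈0 ⟩
      0ᶜ                       ≈⟨ ℂᴿ.zeroʳ _ ⟨
      D ⁻ ⟨ x ⟩ *ᶜ 0ᶜ          ≈⟨ ℂᴿ.*-congˡ (⟨⟩-zero C x≈0) ⟨
      D ⁻ ⟨ x ⟩ *ᶜ C ⟨ x ⟩     ∎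
    by-cases (no x≉0) = begin
      B ⟨ x ⟩                                          ≈⟨ ℂᴿ.*-identityˡ _ ⟨
      1ᶜ *ᶜ B ⟨ x ⟩                                    ≈⟨ ℂᴿ.*-congʳ (⁻-inverseˡ-⟨⟩ D x≉0) ⟨
      D ⁻ ⟨ x ⟩ *ᶜ D ⟨ x ⟩ *ᶜ B ⟨ x ⟩                  ≈⟨ ℂᴿ.*-congʳ (ℂᴿ.*-congˡ (D≈B⁻C x)) ⟩
      D ⁻ ⟨ x ⟩ *ᶜ (B ⁻ ⟨ x ⟩ *ᶜ C ⟨ x ⟩) *ᶜ B ⟨ x ⟩
        ≈⟨ solve 4 (λ d b̄ c b → (d ⊕ (b̄ ⊕ c)) ⊕ b ⊜ (d ⊕ c) ⊕ (b̄ ⊕ b)) ℂᴿ.refl _ _ _ _ ⟩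
      D ⁻ ⟨ x ⟩ *ᶜ C ⟨ x ⟩ *ᶜ (B ⁻ ⟨ x ⟩ *ᶜ B ⟨ x ⟩)   ≈⟨ ℂᴿ.*-congˡ (⁻-inverseˡ-⟨⟩ B x≉0) ⟩
      D ⁻ ⟨ x ⟩ *ᶜ C ⟨ x ⟩ *ᶜ 1ᶜ                       ≈⟨ ℂᴿ.*-identityʳ _ ⟩
      D ⁻ ⟨ x ⟩ *ᶜ C ⟨ x ⟩                             ∎

  ⟨-1⟩*⟨-1⟩≈1 : ∀ χ → χ ⟨ - 1# ⟩ *ᶜ χ ⟨ - 1# ⟩ ≈ᶜ 1ᶜ
  ⟨-1⟩*⟨-1⟩≈1 χ = begin
    χ ⟨ - 1# ⟩ *ᶜ χ ⟨ - 1# ⟩   ≈⟨ ⟨⟩-* χ (- 1#) (- 1#) ⟨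
    χ ⟨ - 1# * - 1# ⟩          ≈⟨ ⟨⟩-cong χ -1*-1≈1 ⟩
    χ ⟨ 1# ⟩                   ≈⟨ ⟨1⟩≈1 χ ⟩
    1ᶜ                         ∎
    where open ≈ᶜ

  ⁻-⟨⟩ : ∀ χ {x} → ¬ (x ≈ 0#) → χ ⁻ ⟨ x ⟩ ≈ᶜ χ ⟨ x ⁻¹ ⟩
  ⁻-⟨⟩ χ {x} x≉0 = begin
    χ ⁻ ⟨ x ⟩                              ≈⟨ ℂᴿ.*-identityʳ _ ⟨
    χ ⁻ ⟨ x ⟩ *ᶜ 1ᶜ                        ≈⟨ ℂᴿ.*-congˡ (⟨1⟩≈1 χ) ⟨
    χ ⁻ ⟨ x ⟩ *ᶜ χ ⟨ 1# ⟩                  ≈⟨ ℂᴿ.*-congˡ (⟨⟩-cong χ (⁻¹-inverseʳ x≉0)) ⟨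
    χ ⁻ ⟨ x ⟩ *ᶜ χ ⟨ x * x ⁻¹ ⟩            ≈⟨ ℂᴿ.*-congˡ (⟨⟩-* χ x _) ⟩
    χ ⁻ ⟨ x ⟩ *ᶜ (χ ⟨ x ⟩ *ᶜ χ ⟨ x ⁻¹ ⟩)   ≈⟨ ℂᴿ.*-assoc _ _ _ ⟨
    χ ⁻ ⟨ x ⟩ *ᶜ χ ⟨ x ⟩ *ᶜ χ ⟨ x ⁻¹ ⟩     ≈⟨ ℂᴿ.*-congʳ (⁻-inverseˡ-⟨⟩ χ x≉0) ⟩
    1ᶜ *ᶜ χ ⟨ x ⁻¹ ⟩                       ≈⟨ ℂᴿ.*-identityˡ _ ⟩
    χ ⟨ x ⁻¹ ⟩                             ∎
    where open ≈ᶜ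

  -- Sums over the field: reindexing and removal of one point.

  -- Conjugating `σ` by the enumeration gives an involution of `Fin q`, hence a permutation of the
  -- indices of the sum.
  ∑F-involution : ∀ (σ : Carrier → Carrier) {f} → (∀ {x y} → x ≈ y → σ x ≈ σ y) →
                  (∀ x → σ (σ x) ≈ x) → (∀ {x y} → x ≈ y → f x ≈ᶜ f y) →
                  ∑F f ≈ᶜ ∑F (f ∘ σ)
  ∑F-involution σ {f} σ-cong σ-involutive f-cong =
    ℂᴿ.trans (Σᶜ.sum-permute (f ∘ to) π) (Σᶜ.sum-cong-≋ {q} λ i → f-cong (strictlyInverseˡ (σ (to i))))
    where
    σ′ : Fin q → Fin q
    σ′ i = from (σ (to i))
    σ′-involutive : ∀ i → σ′ (σ′ i) ≡ i
    σ′-involutive i = ≡.trans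
      (from-cong (trans (σ-cong (strictlyInverseˡ _)) (σ-involutive (to i))))
      (strictlyInverseʳ i)
    π : Permutation q q
    π = permutation σ′ σ′ σ′-involutive σ′-involutive

  if-true : ∀ {p} {P : Set p} (P? : Dec P) {z} → P → (if does P? then 0ᶜ else z) ≈ᶜ 0ᶜ
  if-true (yes _) p = ℂᴿ.refl
  if-true (no ¬p) p = ⊥-elim (¬p p)

  if-false : ∀ {p} {P : Set p} (P? : Dec P) {z} → ¬ P → (if does P? then 0ᶜ else z) ≈ᶜ z
  if-false (yes p) ¬p = ⊥-elim (¬p p)
  if-false (no _)  ¬p = ℂᴿ.refl

  if-cong : ∀ {p} {P : Set p} (P? : Dec P) {z w} → (¬ P → z ≈ᶜ w) →
            (if does P? then 0ᶜ else z) ≈ᶜ (if does P? then 0ᶜ else w)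
  if-cong (yes _) z≈w = ℂᴿ.refl
  if-cong (no ¬p) z≈w = z≈w ¬p

  *-distribˡ-if : ∀ {p} {P : Set p} (P? : Dec P) z {w} →
                  z *ᶜ (if does P? then 0ᶜ else w) ≈ᶜ (if does P? then 0ᶜ else z *ᶜ w)
  *-distribˡ-if (yes _) z = ℂᴿ.zeroʳ z
  *-distribˡ-if (no _)  z = ℂᴿ.refl

  ∑F≢-cong : ∀ a {f g} → (∀ t → ¬ (t ≈ a) → f t ≈ᶜ g t) → ∑F≢ a f ≈ᶜ ∑F≢ a g
  ∑F≢-cong a f≈g = Σᶜ.sum-cong-≋ {q} λ i → if-cong (to i ≟ a) (f≈g (to i))

  *-distribˡ-∑F≢ : ∀ a z f → z *ᶜ ∑F≢ a f ≈ᶜ ∑F≢ a (λ t → z *ᶜ f t)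
  *-distribˡ-∑F≢ a z f = ℂᴿ.trans (Σᶜ.*-distribˡ-sum {q} z _)
    (Σᶜ.sum-cong-≋ {q} λ i → *-distribˡ-if (to i ≟ a) z)

  -- The masked function `g` is 0 at the index of `a` and agrees with `f` at all others, so `f`
  -- differs from `g` by the summand `f a` at that single index.
  ∑F-split : ∀ a {f} → (∀ {x y} → x ≈ y → f x ≈ᶜ f y) → ∑F f ≈ᶜ f a +ᶜ ∑F≢ a f
  ∑F-split a {f} f-cong = sum-cong-except ℂᴿ.+-commutativeMonoid (from a) at-a off-a
    where
    g : Carrier → ℂ
    g t = if does (t ≟ a) then 0ᶜ else f t
    to[from[a]]≈a : to (from a) ≈ a
    to[from[a]]≈a = strictlyInverseˡ a
    at-a : f (to (from a)) ≈ᶜ f a +ᶜ g (to (from a))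
    at-a = ℂᴿ.trans (f-cong to[from[a]]≈a) (ℂᴿ.sym (ℂᴿ.trans
      (ℂᴿ.+-congˡ (if-true (to (from a) ≟ a) to[from[a]]≈a)) (ℂᴿ.+-identityʳ (f a))))
    off-a : ∀ j → j ≢ from a → f (to j) ≈ᶜ g (to j)
    off-a j j≢ = ℂᴿ.sym (if-false (to j ≟ a) λ to[j]≈a →
      j≢ (≡.trans (≡.sym (strictlyInverseʳ j)) (from-cong to[j]≈a)))

  -- Iterated sums over vectors.

  -- Vectors are functions, and rebuilt vectors agree with the original ones only entry by entry;
  -- reindexing a sum therefore asks this of its summand.
  Extensional : ∀ {m} → (Vector Carrier m → ℂ) → Set _
  Extensional f = ∀ {s t} → (∀ i → s i ≈ t i) → f s ≈ᶜ f t

  ∑Fⁿ-cong : ∀ m {f g} → (∀ t → f t ≈ᶜ g t) → ∑Fⁿ m f ≈ᶜ ∑Fⁿ m g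
  ∑Fⁿ-cong zero    f≈g = f≈g []
  ∑Fⁿ-cong (suc m) f≈g = Σᶜ.sum-cong-≋ {q} λ i → ∑Fⁿ-cong m λ ts → f≈g (to i ∷ ts)

  *-distribˡ-∑Fⁿ : ∀ m z f → z *ᶜ ∑Fⁿ m f ≈ᶜ ∑Fⁿ m (λ t → z *ᶜ f t)
  *-distribˡ-∑Fⁿ zero    z f = ℂᴿ.refl
  *-distribˡ-∑Fⁿ (suc m) z f = ℂᴿ.trans (Σᶜ.*-distribˡ-sum {q} z _)
    (Σᶜ.sum-cong-≋ {q} λ i → *-distribˡ-∑Fⁿ m z λ ts → f (to i ∷ ts))

  ∷-cong : ∀ {m s t} {ss ts : Vector Carrier m} → s ≈ t → (∀ i → ss i ≈ ts i) →
           ∀ i → (s ∷ ss) i ≈ (t ∷ ts) i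
  ∷-cong s≈t ss≈ts zero    = s≈t
  ∷-cong s≈t ss≈ts (suc i) = ss≈ts i

  -- Induction on `k`: the inner sum is rearranged first, and then the sum over coordinate `k` is
  -- exchanged with the sum over the leading coordinate.
  ∑Fⁿ-insertAt : ∀ {m} (k : Fin (suc m)) {f} → Extensional f →
                 ∑Fⁿ (suc m) f ≈ᶜ ∑F λ t → ∑Fⁿ m λ ts → f (insertAt ts k t)
  ∑Fⁿ-insertAt {m} zero f-ext = Σᶜ.sum-cong-≋ {q} λ t → ∑Fⁿ-cong m λ ts → f-ext
    λ { zero → refl ; (suc i) → refl }
  ∑Fⁿ-insertAt {suc m} (suc k) {f} f-ext = begin
    (∑F λ t₀ → ∑Fⁿ (suc m) λ ts → f (t₀ ∷ ts))
      ≈⟨ Σᶜ.sum-cong-≋ {q} (λ t₀ → ∑Fⁿ-insertAt k (f-ext ∘ ∷-cong refl)) ⟩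
    (∑F λ t₀ → ∑F λ t → ∑Fⁿ m λ ts → f (t₀ ∷ insertAt ts k t))
      ≈⟨ Σᶜ.∑-comm (λ i j → ∑Fⁿ m λ ts → f (to i ∷ insertAt ts k (to j))) ⟩
    (∑F λ t → ∑F λ t₀ → ∑Fⁿ m λ ts → f (t₀ ∷ insertAt ts k t))
      ≈⟨ Σᶜ.sum-cong-≋ {q} (λ t → Σᶜ.sum-cong-≋ {q} λ t₀ → ∑Fⁿ-cong m λ ts → f-ext
           λ { zero → refl ; (suc i) → refl }) ⟩
    (∑F λ t → ∑F λ t₀ → ∑Fⁿ m λ ts → f (insertAt (t₀ ∷ ts) (suc k) t))
      ∎
    where open ≈ᶜ

  ∑Fⁿ-updateAt : ∀ {m} (l : Fin m) (σ : Carrier → Carrier) {f} →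
                 (∀ {x y} → x ≈ y → σ x ≈ σ y) → (∀ x → σ (σ x) ≈ x) → Extensional f →
                 ∑Fⁿ m f ≈ᶜ ∑Fⁿ m λ ts → f (updateAt ts l σ)
  ∑Fⁿ-updateAt {suc m} zero σ {f} σ-cong σ-involutive f-ext = begin
    (∑F λ t → ∑Fⁿ m λ ts → f (t ∷ ts))
      ≈⟨ ∑F-involution σ σ-cong σ-involutive
           (λ x≈y → ∑Fⁿ-cong m λ ts → f-ext (∷-cong x≈y λ _ → refl)) ⟩
    (∑F λ t → ∑Fⁿ m λ ts → f (σ t ∷ ts))
      ≈⟨ Σᶜ.sum-cong-≋ {q} (λ t → ∑Fⁿ-cong m λ ts → f-ext λ { zero → refl ; (suc i) → refl }) ⟩
    (∑F λ t → ∑Fⁿ m λ ts → f (updateAt (t ∷ ts) zero σ))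
      ∎
    where open ≈ᶜ
  ∑Fⁿ-updateAt {suc m} (suc l) σ {f} σ-cong σ-involutive f-ext = Σᶜ.sum-cong-≋ {q} λ t →
    ℂᴿ.trans (∑Fⁿ-updateAt l σ σ-cong σ-involutive (f-ext ∘ ∷-cong refl))
      (∑Fⁿ-cong m λ ts → f-ext λ { zero → refl ; (suc i) → refl })

  -- The integrand, with a parameter in the argument of `A ⁻`.

  -- Opaque, so that conversion never reaches the characters B ⁻ · C.
  opaque
    weight : (B C : Character) → Carrier → Carrier → ℂ
    weight B C x t =
      ε ⟨ x ⟩ *ᶜ ((B · C) ⟨ - 1# ⟩ *ᶜ 1/q) *ᶜ B ⟨ t ⟩ *ᶜ (B ⁻ · C) ⟨ 1# - t ⟩

    -- The weight sees `x` only through `ε ⟨ x ⟩`. The hypothesis is kept this weak so that `x i`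
    -- can be replaced by `x i / s` or `- x i / x l`.
    weight-cong : ∀ {B B′ C C′ x y s t} → B ≡ B′ → C ≡ C′ → ε ⟨ x ⟩ ≈ᶜ ε ⟨ y ⟩ → s ≈ t →
                  weight B C x s ≈ᶜ weight B′ C′ y t
    weight-cong {B} {_} {C} ≡.refl ≡.refl εx≈εy s≈t =
      ℂᴿ.*-cong (ℂᴿ.*-cong (ℂᴿ.*-congʳ εx≈εy) (⟨⟩-cong B s≈t))
        (⟨⟩-cong (B ⁻ · C) (+-congˡ (-‿cong s≈t)))

    weight-≉0 : ∀ {D B C x} t → IsRatio D B C → ¬ (x ≈ 0#) →
                weight B C x t ≈ᶜ ((B · C) ⟨ - 1# ⟩ *ᶜ 1/q) *ᶜ (B ⟨ t ⟩ *ᶜ D ⟨ 1# - t ⟩)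
    weight-≉0 {D} {B} {C} t D≈B⁻C x≉0 = ℂᴿ.trans (ℂᴿ.*-assoc _ _ _) (ℂᴿ.*-cong
      (ℂᴿ.trans (ℂᴿ.*-congʳ (ε⟨⟩≈1 x≉0)) (ℂᴿ.*-identityˡ _))
      (ℂᴿ.*-congˡ (ℂᴿ.trans (⟨⟩-product (B ⁻) C (λ _ → ℂᴿ.refl) (1# - t)) (ℂᴿ.sym (D≈B⁻C (1# - t))))))

  integrand : ∀ {m} → Character → (B C : Vector Character m) (x : Vector Carrier m) →
              Carrier → Vector Carrier m → ℂ
  integrand A B C x s t =
    ∏ (λ i → weight (B i) (C i) (x i) (t i)) *ᶜ A ⁻ ⟨ s - Σᶠ.sum (λ i → x i * t i) ⟩

  -- Fᴬ with the 1 in the argument of A ⁻ replaced by a free parameter s, so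
  -- that summing out one variable gives values of the same function.
  Fₛ : ∀ m → Character → (B C : Vector Character m) → Vector Carrier m → Carrier → ℂ
  Fₛ m A B C x s = ∑Fⁿ m (integrand A B C x s)

  opaque
    unfolding weight

    -- With `weight` unfolded both sides are literally the same sum; later arguments pass between
    -- them through this equation alone.
    Fᴬ≡Fₛ : ∀ m A (B C : Vector Character m) x → Fᴬ m A B C x ≡ Fₛ m A B C x 1#
    Fᴬ≡Fₛ m A B C x = ≡.refl

  integrand-ext : ∀ {m} A (B C : Vector Character m) x s → Extensional (integrand A B C x s)
  integrand-ext A B C x s t≈t′ = ℂᴿ.*-cong
    (Πᶜ.sum-cong-≋ λ i → weight-cong ≡.refl ≡.refl ℂᴿ.refl (t≈t′ i))
    (⟨⟩-cong (A ⁻) (+-congˡ (-‿cong (Σᶠ.sum-cong-≋ λ i → *-congˡ (t≈t′ i)))))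

  Fₛ-cong : ∀ m A (B C : Vector Character m) x {s s′} → s ≈ s′ → Fₛ m A B C x s ≈ᶜ Fₛ m A B C x s′
  Fₛ-cong m A B C x s≈s′ = ∑Fⁿ-cong m λ t → ℂᴿ.*-congˡ (⟨⟩-cong (A ⁻) (+-congʳ s≈s′))

  ε-/ : ∀ x {s} → ¬ (s ≈ 0#) → ε ⟨ x / s ⟩ ≈ᶜ ε ⟨ x ⟩
  ε-/ x {s} s≉0 = ℂᴿ.trans (⟨⟩-* ε x (s ⁻¹))
    (ℂᴿ.trans (ℂᴿ.*-congˡ (ε⟨⟩≈1 (⁻¹-≉0 s≉0))) (ℂᴿ.*-identityʳ _))

  -- Factoring `s` out of the argument of `A ⁻` divides each `x i` by `s`; the weights do not
  -- notice, because `ε ⟨ x i / s ⟩` equals `ε ⟨ x i ⟩`.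
  Fₛ-rescale : ∀ m A (B C : Vector Character m) x {s} → ¬ (s ≈ 0#) →
               Fₛ m A B C x s ≈ᶜ A ⁻ ⟨ s ⟩ *ᶜ Fᴬ m A B C (λ i → x i / s)
  Fₛ-rescale m A B C x {s} s≉0 =
    ℂᴿ.trans (∑Fⁿ-cong m pointwise) (ℂᴿ.trans (ℂᴿ.sym (*-distribˡ-∑Fⁿ m _ _))
      (ℂᴿ.*-congˡ (ℂᴿ.reflexive (≡.sym (Fᴬ≡Fₛ m A B C _)))))
    where
    argument : ∀ t → s - Σᶠ.sum (λ i → x i * t i) ≈ s * (1# - Σᶠ.sum (λ i → x i / s * t i))
    argument t = begin
      s - Σᶠ.sum (λ i → x i * t i)
        ≈⟨ +-cong (*-identityʳ s) (-‿cong (Σᶠ.sum-cong-≋ λ i →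
             trans (sym (*-assoc _ _ _)) (*-congʳ (*-/-cancel (x i) s≉0)))) ⟨
      s * 1# - Σᶠ.sum (λ i → s * (x i / s * t i))
        ≈⟨ +-congˡ (-‿cong (Σᶠ.*-distribˡ-sum {m} s _)) ⟨
      s * 1# - s * Σᶠ.sum (λ i → x i / s * t i)
        ≈⟨ x[y-z]≈xy-xz s _ _ ⟨
      s * (1# - Σᶠ.sum (λ i → x i / s * t i))
        ∎
      where open ≈ᶠ
    pointwise : ∀ t → integrand A B C x s t ≈ᶜ A ⁻ ⟨ s ⟩ *ᶜ integrand A B C (λ i → x i / s) 1# t
    pointwise t = ℂᴿ.trans
      (ℂᴿ.*-cong
        (Πᶜ.sum-cong-≋ λ i → weight-cong ≡.refl ≡.refl (ℂᴿ.sym (ε-/ (x i) s≉0)) refl)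
        (ℂᴿ.trans (⟨⟩-cong (A ⁻) (argument t)) (⟨⟩-* (A ⁻) s _)))
      (solve 3 (λ a b c → a ⊕ (b ⊕ c) ⊜ b ⊕ (a ⊕ c)) ℂᴿ.refl _ _ _)
      where open ℂ*-Solver

  -- The reflection of one variable when the parameter is 0.

  -- Character values at -1 square to 1, so `B` and `B ⁻` agree there and two factors `C ⟨ - 1# ⟩`
  -- cancel. This is the origin of the factor `C l ⟨ - 1# ⟩` in the theorem.
  ratio-sign : ∀ {D B C} → IsRatio D B C →
               (B · C) ⟨ - 1# ⟩ ≈ᶜ C ⟨ - 1# ⟩ *ᶜ (D · C) ⟨ - 1# ⟩
  ratio-sign {D} {B} {C} D≈B⁻C = begin
    (B · C) ⟨ - 1# ⟩                  ≈⟨ ⟨⟩-product B C (λ _ → ℂᴿ.refl) (- 1#) ⟩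
    b *ᶜ γ                            ≈⟨ solve 2 (λ b c → b ⊕ c ⊜ c ⊕ ((id ⊕ b) ⊕ id)) ℂᴿ.refl b γ ⟩
    -- The first 1 becomes `b̄ *ᶜ b` and the second `γ *ᶜ γ`; the surplus `b *ᶜ b` is then removed.
    γ *ᶜ (1ᶜ *ᶜ b *ᶜ 1ᶜ)
      ≈⟨ ℂᴿ.*-congˡ (ℂᴿ.*-cong (ℂᴿ.*-congʳ (⁻-inverseˡ-⟨⟩ B -1≉0)) (⟨-1⟩*⟨-1⟩≈1 C)) ⟨
    γ *ᶜ ((b̄ *ᶜ b) *ᶜ b *ᶜ (γ *ᶜ γ))
      ≈⟨ solve 3 (λ a b c → c ⊕ (((a ⊕ b) ⊕ b) ⊕ (c ⊕ c)) ⊜ (c ⊕ ((a ⊕ c) ⊕ c)) ⊕ (b ⊕ b)) ℂᴿ.refl b̄ b γ ⟩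
    γ *ᶜ ((b̄ *ᶜ γ) *ᶜ γ) *ᶜ (b *ᶜ b)  ≈⟨ ℂᴿ.*-congˡ (⟨-1⟩*⟨-1⟩≈1 B) ⟩
    γ *ᶜ ((b̄ *ᶜ γ) *ᶜ γ) *ᶜ 1ᶜ        ≈⟨ ℂᴿ.*-identityʳ _ ⟩
    γ *ᶜ ((b̄ *ᶜ γ) *ᶜ γ)              ≈⟨ ℂᴿ.*-congˡ (ℂᴿ.*-congʳ (D≈B⁻C (- 1#))) ⟨
    γ *ᶜ (D ⟨ - 1# ⟩ *ᶜ γ)            ≈⟨ ℂᴿ.*-congˡ (⟨⟩-product D C (λ _ → ℂᴿ.refl) (- 1#)) ⟨
    γ *ᶜ (D · C) ⟨ - 1# ⟩             ∎
    where
    open ≈ᶜ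
    open ℂ*-Solver using (solve; _⊕_; _⊜_; id)
    b = B ⟨ - 1# ⟩
    b̄ = B ⁻ ⟨ - 1# ⟩
    γ = C ⟨ - 1# ⟩

  -- Up to a constant the weight is `B ⟨ t ⟩ *ᶜ D ⟨ 1# - t ⟩`, which the reflection turns into the
  -- same expression with `B` and `D` exchanged. Only the nonvanishing of `x` and `y` matters, so
  -- they may differ.
  weight-reflect : ∀ {D B C x y} t → IsRatio D B C → ¬ (x ≈ 0#) → ¬ (y ≈ 0#) →
                   weight B C x t ≈ᶜ C ⟨ - 1# ⟩ *ᶜ weight D C y (1# - t)
  weight-reflect {D} {B} {C} {x} {y} t D≈B⁻C x≉0 y≉0 = begin
    weight B C x t
      ≈⟨ weight-≉0 {D} {B} {C} t D≈B⁻C x≉0 ⟩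
    β *ᶜ 1/q *ᶜ (B ⟨ t ⟩ *ᶜ δ)
      ≈⟨ ℂᴿ.*-cong (ℂᴿ.*-congʳ (ratio-sign {D} {B} {C} D≈B⁻C))
           (ℂᴿ.*-congʳ (⟨⟩-cong B (sym (x-[x-y]≈y 1# t)))) ⟩
    γ *ᶜ β′ *ᶜ 1/q *ᶜ (b *ᶜ δ)
      ≈⟨ solve 5 (λ a b c d e → ((a ⊕ b) ⊕ c) ⊕ (d ⊕ e) ⊜ a ⊕ ((b ⊕ c) ⊕ (e ⊕ d))) ℂᴿ.refl γ β′ 1/q b δ ⟩
    γ *ᶜ (β′ *ᶜ 1/q *ᶜ (δ *ᶜ b))
      ≈⟨ ℂᴿ.*-congˡ (weight-≉0 {B} {D} {C} (1# - t) (IsRatio-involutive {D} {B} {C} D≈B⁻C) y≉0) ⟨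
    γ *ᶜ weight D C y (1# - t)
      ∎
    where
    open ≈ᶜ
    open ℂ*-Solver using (solve; _⊕_; _⊜_)
    β = (B · C) ⟨ - 1# ⟩
    β′ = (D · C) ⟨ - 1# ⟩
    γ = C ⟨ - 1# ⟩
    δ = D ⟨ 1# - t ⟩
    b = B ⟨ 1# - (1# - t) ⟩

  ε-neg : ∀ x → ε ⟨ - x ⟩ ≈ᶜ ε ⟨ x ⟩
  ε-neg x = begin
    ε ⟨ - x ⟩               ≈⟨ ⟨⟩-cong ε (sym (-1*x≈-x x)) ⟩
    ε ⟨ - 1# * x ⟩          ≈⟨ ⟨⟩-* ε (- 1#) x ⟩
    ε ⟨ - 1# ⟩ *ᶜ ε ⟨ x ⟩   ≈⟨ ℂᴿ.*-congʳ (ε⟨⟩≈1 -1≉0) ⟩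
    1ᶜ *ᶜ ε ⟨ x ⟩           ≈⟨ ℂᴿ.*-identityˡ _ ⟩
    ε ⟨ x ⟩                 ∎
    where open ≈ᶜ

  -- The inner `1#` is the new coefficient at `l`. The right side is then `- x` times the new term,
  -- as at the other indices, plus an extra `x`.
  x*t≈x-x[1-t] : ∀ x t → x * t ≈ x + - x * (1# * (1# - t))
  x*t≈x-x[1-t] x t = begin
    x * t                          ≈⟨ x-[x-y]≈y x (x * t) ⟨
    x - (x - x * t)                ≈⟨ +-congˡ (-‿cong (+-congʳ (*-identityʳ x))) ⟨
    x - (x * 1# - x * t)           ≈⟨ +-congˡ (-‿cong (x[y-z]≈xy-xz x 1# t)) ⟨
    x - x * (1# - t)               ≈⟨ +-congˡ (-‿distribˡ-* x _) ⟩
    x + - x * (1# - t)             ≈⟨ +-congˡ (*-congˡ (*-identityˡ _)) ⟨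
    x + - x * (1# * (1# - t))      ∎
    where open ≈ᶠ

  x*t≈-y[-x/y*t] : ∀ x {y} t → ¬ (y ≈ 0#) → x * t ≈ - y * (- x / y * t)
  x*t≈-y[-x/y*t] x {y} t y≉0 = begin
    x * t                    ≈⟨ -‿involutive _ ⟨
    - - (x * t)              ≈⟨ -‿cong (-‿distribˡ-* x t) ⟩
    - (- x * t)              ≈⟨ -‿cong (*-congʳ (*-/-cancel (- x) y≉0)) ⟨
    - (y * (- x / y) * t)    ≈⟨ -‿cong (*-assoc y _ t) ⟩
    - (y * (- x / y * t))    ≈⟨ -‿distribˡ-* y _ ⟩
    - y * (- x / y * t)      ∎
    where open ≈ᶠ

  -- B′ and y replace B and x under the substitution t_l ↦ 1 − t_l.
  module Reflection {m} (B C B′ : Vector Character m) (x y : Vector Carrier m) (l : Fin m)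
    (xₗ≉0 : ¬ (x l ≈ 0#))
    (B′ₗ-ratio : IsRatio (B′ l) (B l) (C l)) (B′≡ : ∀ i → i ≢ l → B′ i ≡ B i)
    (yₗ≡ : y l ≡ 1#) (y≡ : ∀ i → i ≢ l → y i ≡ - x i / x l) where

    σ : Carrier → Carrier
    σ t = 1# - t

    σ-cong : ∀ {s t} → s ≈ t → σ s ≈ σ t
    σ-cong s≈t = +-congˡ (-‿cong s≈t)

    reflect : Vector Carrier m → Vector Carrier m
    reflect t = updateAt t l σ

    weight-at-l : ∀ t → weight (B l) (C l) (x l) (t l) ≈ᶜ
                  C l ⟨ - 1# ⟩ *ᶜ weight (B′ l) (C l) (y l) (reflect t l)
    weight-at-l t = ℂᴿ.trans
      (weight-reflect {B′ l} {B l} {C l} (t l) B′ₗ-ratio xₗ≉0 1≉0)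
      (ℂᴿ.*-congˡ (ℂᴿ.sym (weight-cong {B′ l} {B′ l} ≡.refl ≡.refl
        (⟨⟩-cong ε (reflexive yₗ≡)) (reflexive (updateAt-updates l t)))))

    weight-off-l : ∀ t i → i ≢ l → weight (B i) (C i) (x i) (t i) ≈ᶜ
                   weight (B′ i) (C i) (y i) (reflect t i)
    weight-off-l t i i≢l = weight-cong {B i} {B′ i} (≡.sym (B′≡ i i≢l)) ≡.refl
      (ℂᴿ.sym (ℂᴿ.trans (⟨⟩-cong ε (reflexive (y≡ i i≢l))) (ℂᴿ.trans (ε-/ (- x i) xₗ≉0) (ε-neg (x i)))))
      (reflexive (≡.sym (updateAt-minimal i l t i≢l)))

    ∏-weight : ∀ t → Πᶜ.sum (λ i → weight (B i) (C i) (x i) (t i)) ≈ᶜ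
               C l ⟨ - 1# ⟩ *ᶜ Πᶜ.sum (λ i → weight (B′ i) (C i) (y i) (reflect t i))
    ∏-weight t = sum-cong-except ℂᴿ.*-commutativeMonoid l (weight-at-l t) (weight-off-l t)

    term-at-l : ∀ t → x l * t l ≈ x l + - x l * (y l * reflect t l)
    term-at-l t = trans (x*t≈x-x[1-t] (x l) (t l)) (+-congˡ (*-congˡ (*-cong
      (reflexive (≡.sym yₗ≡)) (reflexive (≡.sym (updateAt-updates l t))))))

    term-off-l : ∀ t i → i ≢ l → x i * t i ≈ - x l * (y i * reflect t i)
    term-off-l t i i≢l = trans (x*t≈-y[-x/y*t] (x i) (t i) xₗ≉0) (*-congˡ (*-cong
      (reflexive (≡.sym (y≡ i i≢l))) (reflexive (≡.sym (updateAt-minimal i l t i≢l)))))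

    -- Every term carries the factor `- x l`, and index `l` contributes an additional `x l`. With
    -- the outer minus sign, that addition supplies the `1#` once `- x l` is factored out.
    argument-reflect : ∀ t → 0# - Σᶠ.sum (λ i → x i * t i) ≈
                       - x l * (1# - Σᶠ.sum (λ i → y i * reflect t i))
    argument-reflect t = begin
      0# - Σᶠ.sum (λ i → x i * t i)
        ≈⟨ +-identityˡ _ ⟩
      - Σᶠ.sum (λ i → x i * t i)
        ≈⟨ -‿cong (sum-cong-except +-commutativeMonoid l (term-at-l t) (term-off-l t)) ⟩
      - (x l + Σᶠ.sum (λ i → - x l * yu i))
        ≈⟨ -‿+-comm _ _ ⟨
      - x l - Σᶠ.sum (λ i → - x l * yu i)
        ≈⟨ +-cong (*-identityʳ _) (-‿cong (Σᶠ.*-distribˡ-sum {m} (- x l) yu)) ⟨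
      - x l * 1# - - x l * Σᶠ.sum yu
        ≈⟨ x[y-z]≈xy-xz (- x l) _ _ ⟨
      - x l * (1# - Σᶠ.sum yu)
        ∎
      where
      open ≈ᶠ
      yu : Vector Carrier m
      yu i = y i * reflect t i

    integrand-reflect : ∀ A t → integrand A B C x 0# t ≈ᶜ
                        A ⁻ ⟨ - x l ⟩ *ᶜ C l ⟨ - 1# ⟩ *ᶜ integrand A B′ C y 1# (reflect t)
    integrand-reflect A t = ℂᴿ.trans
      (ℂᴿ.*-cong (∏-weight t) (ℂᴿ.trans (⟨⟩-cong (A ⁻) (argument-reflect t)) (⟨⟩-* (A ⁻) (- x l) r)))
      (solve 4 (λ a b c d → (a ⊕ b) ⊕ (c ⊕ d) ⊜ (c ⊕ a) ⊕ (b ⊕ d)) ℂᴿ.refl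
        (C l ⟨ - 1# ⟩) (Πᶜ.sum λ i → weight (B′ i) (C i) (y i) (reflect t i))
        (A ⁻ ⟨ - x l ⟩) (A ⁻ ⟨ r ⟩))
      where
      open ℂ*-Solver using (solve; _⊕_; _⊜_)
      r = 1# - Σᶠ.sum (λ i → y i * reflect t i)

    -- Each integrand is a constant times the new integrand at the reflected point, and reflection
    -- merely permutes the points of summation.
    Fₛ-reflect : ∀ A → Fₛ m A B C x 0# ≈ᶜ A ⁻ ⟨ - x l ⟩ *ᶜ C l ⟨ - 1# ⟩ *ᶜ Fₛ m A B′ C y 1#
    Fₛ-reflect A = begin
      Fₛ m A B C x 0#                    ≈⟨ ∑Fⁿ-cong m (integrand-reflect A) ⟩
      ∑Fⁿ m (λ t → z *ᶜ f (reflect t))   ≈⟨ *-distribˡ-∑Fⁿ m z (f ∘ reflect) ⟨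
      z *ᶜ ∑Fⁿ m (λ t → f (reflect t))   ≈⟨ ℂᴿ.*-congˡ reindex ⟨
      z *ᶜ Fₛ m A B′ C y 1#              ∎
      where
      open ≈ᶜ
      z = A ⁻ ⟨ - x l ⟩ *ᶜ C l ⟨ - 1# ⟩
      f = integrand A B′ C y 1#
      reindex : ∑Fⁿ m f ≈ᶜ ∑Fⁿ m (λ t → f (reflect t))
      reindex = ∑Fⁿ-updateAt l σ {f} σ-cong (x-[x-y]≈y 1#) (integrand-ext A B′ C y 1#)

  -- Summing over variable `k` last.

  -- The contribution of a fixed `t_k = t` once all other variables are summed out, with `z` in the
  -- role of `x k`.
  summand : ∀ {m} → Character → (b c : Character) → Carrier → (B C : Vector Character m) →
            Vector Carrier m → Carrier → ℂ
  summand {m} A b c z B C x t = weight b c z t *ᶜ Fₛ m A B C x (1# - z * t)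

  -- With coordinate `k` outermost, its weight leaves the product, and its term of the linear form
  -- is absorbed into the parameter as `1# - x k * t`.
  Fᴬ-split : ∀ {m} A (B C : Vector Character (suc m)) x k (B° C° : Vector Character m) →
             (∀ j → B (punchIn k j) ≡ B° j) → (∀ j → C (punchIn k j) ≡ C° j) →
             Fᴬ (suc m) A B C x ≈ᶜ ∑F (summand A (B k) (C k) (x k) B° C° (removeAt x k))
  Fᴬ-split {m} A B C x k B° C° B≡B° C≡C° = ℂᴿ.trans (ℂᴿ.reflexive (Fᴬ≡Fₛ (suc m) A B C x))
    (ℂᴿ.trans (∑Fⁿ-insertAt k (integrand-ext A B C x 1#)) (Σᶜ.sum-cong-≋ {q} λ i →
      ℂᴿ.trans (∑Fⁿ-cong m (pointwise (to i))) (ℂᴿ.sym (*-distribˡ-∑Fⁿ m _ _))))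
    where
    pointwise : ∀ t ts → integrand A B C x 1# (insertAt ts k t) ≈ᶜ weight (B k) (C k) (x k) t
                  *ᶜ integrand A B° C° (removeAt x k) (1# - x k * t) ts
    pointwise t ts = ℂᴿ.trans (ℂᴿ.*-cong product (⟨⟩-cong (A ⁻) argument)) (ℂᴿ.*-assoc _ _ _)
      where
      inserted : ∀ j → insertAt ts k t (punchIn k j) ≈ ts j
      inserted j = reflexive (insertAt-punchIn ts k t j)
      product : ∏ (λ i → weight (B i) (C i) (x i) (insertAt ts k t i)) ≈ᶜ
                weight (B k) (C k) (x k) t *ᶜ
                ∏ (λ j → weight (B° j) (C° j) (removeAt x k j) (ts j))
      product = ℂᴿ.trans
        (Πᶜ.sum-remove {i = k} λ i → weight (B i) (C i) (x i) (insertAt ts k t i)) (ℂᴿ.*-cong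
          (weight-cong {B k} {B k} {C k} {C k} ≡.refl ≡.refl ℂᴿ.refl (reflexive (insertAt-lookup ts k t)))
          (Πᶜ.sum-cong-≋ {m} λ j → weight-cong {B (punchIn k j)} {B° j} {C (punchIn k j)} {C° j}
            (B≡B° j) (C≡C° j) ℂᴿ.refl (inserted j)))
      argument : 1# - Σᶠ.sum (λ i → x i * insertAt ts k t i) ≈
                 1# - x k * t - Σᶠ.sum (λ j → removeAt x k j * ts j)
      argument = trans
        (+-congˡ (-‿cong (trans (Σᶠ.sum-remove {i = k} λ i → x i * insertAt ts k t i) (+-cong
          (*-congˡ (reflexive (insertAt-lookup ts k t)))
          (Σᶠ.sum-cong-≋ {m} λ j → *-congˡ (inserted j))))))
        (x-[y+z]≈[x-y]-z _ _ _)

  -- The term at `x k ⁻¹` and the remaining terms.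

  -- Since `1# - x ⁻¹` is `(x - 1#) * x ⁻¹`, a factor `D ⟨ x ⁻¹ ⟩` appears; its `B ⁻` part cancels
  -- `B ⟨ x ⁻¹ ⟩`, and its `C` part is `C ⁻ ⟨ x ⟩`.
  ⟨x⁻¹⟩*⟨1-x⁻¹⟩ : ∀ {D B C x} → IsRatio D B C → ¬ (x ≈ 0#) →
    B ⟨ x ⁻¹ ⟩ *ᶜ D ⟨ 1# - x ⁻¹ ⟩ ≈ᶜ D ⟨ x - 1# ⟩ *ᶜ C ⁻ ⟨ x ⟩
  ⟨x⁻¹⟩*⟨1-x⁻¹⟩ {D} {B} {C} {x} D≈B⁻C x≉0 = begin
    B ⟨ x⁻¹ ⟩ *ᶜ D ⟨ 1# - x⁻¹ ⟩
      ≈⟨ ℂᴿ.*-congˡ (ℂᴿ.trans (⟨⟩-cong D 1-x⁻¹≈[x-1]x⁻¹) (⟨⟩-* D _ _)) ⟩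
    B ⟨ x⁻¹ ⟩ *ᶜ (D ⟨ x - 1# ⟩ *ᶜ D ⟨ x⁻¹ ⟩)
      ≈⟨ ℂᴿ.*-congˡ (ℂᴿ.*-congˡ (D≈B⁻C x⁻¹)) ⟩
    B ⟨ x⁻¹ ⟩ *ᶜ (D ⟨ x - 1# ⟩ *ᶜ (B ⁻ ⟨ x⁻¹ ⟩ *ᶜ C ⟨ x⁻¹ ⟩))
      ≈⟨ solve 4 (λ a b c d → a ⊕ (b ⊕ (c ⊕ d)) ⊜ b ⊕ ((c ⊕ a) ⊕ d)) ℂᴿ.refl _ _ _ _ ⟩
    D ⟨ x - 1# ⟩ *ᶜ (B ⁻ ⟨ x⁻¹ ⟩ *ᶜ B ⟨ x⁻¹ ⟩ *ᶜ C ⟨ x⁻¹ ⟩)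
      ≈⟨ ℂᴿ.*-congˡ (ℂᴿ.*-congʳ (⁻-inverseˡ-⟨⟩ B (⁻¹-≉0 x≉0))) ⟩
    D ⟨ x - 1# ⟩ *ᶜ (1ᶜ *ᶜ C ⟨ x⁻¹ ⟩)
      ≈⟨ ℂᴿ.*-congˡ (ℂᴿ.trans (ℂᴿ.*-identityˡ _) (ℂᴿ.sym (⁻-⟨⟩ C x≉0))) ⟩
    D ⟨ x - 1# ⟩ *ᶜ C ⁻ ⟨ x ⟩
      ∎
    where
    open ≈ᶜ
    open ℂ*-Solver using (solve; _⊕_; _⊜_)
    x⁻¹ = x ⁻¹
    1-x⁻¹≈[x-1]x⁻¹ : 1# - x⁻¹ ≈ (x - 1#) * x⁻¹
    1-x⁻¹≈[x-1]x⁻¹ = sym (trans ([y-z]x≈yx-zx _ _ _)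
      (+-cong (⁻¹-inverseʳ x≉0) (-‿cong (*-identityˡ _))))

  module Reduction {m} (A : Character) (B C : Vector Character (suc m)) (x : Vector Carrier (suc m))
    (k l : Fin (suc m)) (k≢l : k ≢ l) (xₗ≉0 : ¬ (x l ≈ 0#)) (xₖ≉0 : ¬ (x k ≈ 0#))
    (B° C° : Vector Character m)
    (B≡B° : ∀ j → B (punchIn k j) ≡ B° j) (C≡C° : ∀ j → C (punchIn k j) ≡ C° j)
    {Dₖ : Character} {B′ : Vector Character m} {y : Vector Carrier m}
    (B′≡B° : ∀ i → i ≢ punchOut k≢l → B′ i ≡ B° i)
    (y≡1 : y (punchOut k≢l) ≡ 1#)
    (y≡-x/x : ∀ i → i ≢ punchOut k≢l → y i ≡ - removeAt x k i / x l)
    (Dₖ-ratio : IsRatio Dₖ (B k) (C k))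
    (B′-ratio : IsRatio (B′ (punchOut k≢l)) (B l) (C l)) where

    l′ : Fin m
    l′ = punchOut k≢l

    x° : Vector Carrier m
    x° = removeAt x k

    Bₗ≡ : B° l′ ≡ B l
    Bₗ≡ = ≡.trans (≡.sym (B≡B° l′)) (≡.cong B (punchIn-punchOut k≢l))

    Cₗ≡ : C° l′ ≡ C l
    Cₗ≡ = ≡.trans (≡.sym (C≡C° l′)) (≡.cong C (punchIn-punchOut k≢l))

    xₗ≡ : x° l′ ≡ x l
    xₗ≡ = removeAt-punchOut x k≢l

    S : Carrier → ℂ
    S = summand A (B k) (C k) (x k) B° C° x°

    S-cong : ∀ {s t} → s ≈ t → S s ≈ᶜ S t
    S-cong s≈t = ℂᴿ.*-cong (weight-cong {B k} {B k} {C k} {C k} ≡.refl ≡.refl ℂᴿ.refl s≈t)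
      (Fₛ-cong m A B° C° x° (+-congˡ (-‿cong (*-congˡ s≈t))))

    β : ℂ
    β = (B k · C k) ⟨ - 1# ⟩ *ᶜ 1/q

    rescaled : Carrier → ℂ
    rescaled t = Fᴬ m A B° C° (λ i → x° i / (1# - x k * t))

    generic-term : Carrier → ℂ
    generic-term t = B k ⟨ t ⟩ *ᶜ Dₖ ⟨ 1# - t ⟩ *ᶜ A ⁻ ⟨ 1# - x k * t ⟩ *ᶜ rescaled t

    -- Here `1# - x k * t` is nonzero, so the inner sum can be rescaled.
    generic : ∀ t → ¬ (t ≈ x k ⁻¹) → S t ≈ᶜ β *ᶜ generic-term t
    generic t t≉x⁻¹ = ℂᴿ.trans
      (ℂᴿ.*-cong (weight-≉0 {Dₖ} {B k} {C k} t Dₖ-ratio xₖ≉0)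
        (Fₛ-rescale m A B° C° x° (t≉x⁻¹ ∘ 1-x*y≈0⇒y≈x⁻¹ xₖ≉0)))
      (solve 5 (λ a b c d e → (a ⊕ (b ⊕ c)) ⊕ (d ⊕ e) ⊜ a ⊕ (((b ⊕ c) ⊕ d) ⊕ e)) ℂᴿ.refl
        β (B k ⟨ t ⟩) (Dₖ ⟨ 1# - t ⟩) (A ⁻ ⟨ 1# - x k * t ⟩) (rescaled t))
      where open ℂ*-Solver using (solve; _⊕_; _⊜_)

    reflected : ℂ
    reflected = Fᴬ m A B′ C° y

    Fₛ-0 : Fₛ m A B° C° x° 0# ≈ᶜ A ⁻ ⟨ - x l ⟩ *ᶜ C l ⟨ - 1# ⟩ *ᶜ reflected
    Fₛ-0 = ℂᴿ.trans
      -- The reflection acts at `l′`, the position of `l` once `k` is gone. Entries there equal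
      -- those at `l` only propositionally, hence the transports along `Bₗ≡`, `Cₗ≡` and `xₗ≡`.
      (Reflection.Fₛ-reflect B° C° B′ x° y l′
        (λ xₗ≈0 → xₗ≉0 (trans (reflexive (≡.sym xₗ≡)) xₗ≈0))
        (IsRatio-resp-≡ {B′ l′} {B′ l′} {B° l′} {B l} {C° l′} {C l} ≡.refl Bₗ≡ Cₗ≡ B′-ratio)
        B′≡B° y≡1
        (λ i i≢ → ≡.trans (y≡-x/x i i≢) (≡.cong (λ z → - x° i / z) (≡.sym xₗ≡))) A)
      (ℂᴿ.*-cong
        (ℂᴿ.*-cong (⟨⟩-cong (A ⁻) (-‿cong (reflexive xₗ≡)))
          (ℂᴿ.reflexive (≡.cong (λ χ → χ ⟨ - 1# ⟩) Cₗ≡)))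
        (ℂᴿ.reflexive (≡.sym (Fᴬ≡Fₛ m A B′ C° y))))

    degenerate-term : ℂ
    degenerate-term = β *ᶜ Dₖ ⟨ x k - 1# ⟩ *ᶜ C k ⁻ ⟨ x k ⟩ *ᶜ A ⁻ ⟨ - x l ⟩ *ᶜ C l ⟨ - 1# ⟩ *ᶜ reflected

    -- At this point the parameter `1# - x k * x k ⁻¹` vanishes, so the reflected form of the inner
    -- sum applies.
    degenerate : S (x k ⁻¹) ≈ᶜ degenerate-term
    degenerate = ℂᴿ.trans
      (ℂᴿ.*-cong
        (ℂᴿ.trans (weight-≉0 {Dₖ} {B k} {C k} (x k ⁻¹) Dₖ-ratio xₖ≉0)
          (ℂᴿ.*-congˡ (⟨x⁻¹⟩*⟨1-x⁻¹⟩ {Dₖ} {B k} {C k} Dₖ-ratio xₖ≉0)))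
        (ℂᴿ.trans (Fₛ-cong m A B° C° x°
          (trans (+-congˡ (-‿cong (⁻¹-inverseʳ xₖ≉0))) (-‿inverseʳ 1#))) Fₛ-0))
      (solve 6 (λ a b c d e f → (a ⊕ (b ⊕ c)) ⊕ ((d ⊕ e) ⊕ f) ⊜ ((((a ⊕ b) ⊕ c) ⊕ d) ⊕ e) ⊕ f) ℂᴿ.refl
        β (Dₖ ⟨ x k - 1# ⟩) (C k ⁻ ⟨ x k ⟩) (A ⁻ ⟨ - x l ⟩) (C l ⟨ - 1# ⟩) reflected)
      where open ℂ*-Solver using (solve; _⊕_; _⊜_)

    ∑F-S : ∑F S ≈ᶜ degenerate-term +ᶜ β *ᶜ ∑F≢ (x k ⁻¹) generic-term
    ∑F-S = ℂᴿ.trans (∑F-split (x k ⁻¹) {S} S-cong) (ℂᴿ.+-cong degenerate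
      (ℂᴿ.trans (∑F≢-cong (x k ⁻¹) {S} {λ t → β *ᶜ generic-term t} generic)
        (ℂᴿ.sym (*-distribˡ-∑F≢ (x k ⁻¹) β generic-term))))

    reduction : Fᴬ (suc m) A B C x ≈ᶜ degenerate-term +ᶜ β *ᶜ ∑F≢ (x k ⁻¹) generic-term
    reduction = ℂᴿ.trans {Fᴬ (suc m) A B C x} {∑F S} (Fᴬ-split A B C x k B° C° B≡B° C≡C°) ∑F-S

  -- The lists without k, and the characters B ⁻ · C, enter as variables: a use of
  -- the lemma then solves for them instead of comparing composite characters.
  Fᴬ-reduction : ∀ {m} A (B C : Vector Character (suc m)) x k l (k≢l : k ≢ l) →
    ¬ (x l ≈ 0#) → ¬ (x k ≈ 0#) → (B° C° : Vector Character m) →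
    (∀ j → B (punchIn k j) ≡ B° j) → (∀ j → C (punchIn k j) ≡ C° j) →
    ∀ {Dₖ Dₗ} {B′ : Vector Character m} {y : Vector Carrier m} →
    B′ (punchOut k≢l) ≡ Dₗ → (∀ i → i ≢ punchOut k≢l → B′ i ≡ B° i) →
    y (punchOut k≢l) ≡ 1# →
    (∀ i → i ≢ punchOut k≢l → y i ≡ - removeAt x k i / x l) →
    IsRatio Dₖ (B k) (C k) → IsRatio Dₗ (B l) (C l) →
    Fᴬ (suc m) A B C x
      ≈ᶜ
      (B k · C k) ⟨ - 1# ⟩ *ᶜ 1/q
        *ᶜ Dₖ ⟨ x k - 1# ⟩ *ᶜ C k ⁻ ⟨ x k ⟩
        *ᶜ A ⁻ ⟨ - x l ⟩ *ᶜ C l ⟨ - 1# ⟩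
        *ᶜ Fᴬ m A B′ C° y
      +ᶜ
      (B k · C k) ⟨ - 1# ⟩ *ᶜ 1/q
        *ᶜ ∑F≢ (x k ⁻¹) (λ t →
             B k ⟨ t ⟩ *ᶜ Dₖ ⟨ 1# - t ⟩ *ᶜ A ⁻ ⟨ 1# - x k * t ⟩
             *ᶜ Fᴬ m A B° C° (λ i → removeAt x k i / (1# - x k * t)))
  Fᴬ-reduction A B C x k l k≢l xₗ≉0 xₖ≉0 B° C° B≡B° C≡C° {Dₖ} {_} {B′} {y}
    -- The first `≡.refl` identifies `Dₗ` with the entry of `B′` at the position of `l`, which gives
    -- `Dₗ-ratio` the required type.
    ≡.refl B′≡B° y≡1 y≡-x/x Dₖ-ratio Dₗ-ratio =
    Reduction.reduction A B C x k l k≢l xₗ≉0 xₖ≉0 B° C° B≡B° C≡C° {Dₖ} {B′} {y}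
      B′≡B° y≡1 y≡-x/x Dₖ-ratio Dₗ-ratio

theorem3p2 :
  ∀ {c ℓ : Level} (p r : ℕ) → Prime p → ¬ (2 ∣ p) → 1 ≤ r →
  (F : FiniteField c ℓ (p ^ r)) →
  let open Lauricella F in
  (m : ℕ) → 2 ≤ suc m →
  (A : Character) (B C : Vector Character (suc m)) (x : Vector Carrier (suc m)) →
  (k l : Fin (suc m)) → k ≢ l → ¬ (x l ≈ 0#) → ¬ (x k ≈ 0#) →
  Fᴬ (suc m) A B C x
    ≈ᶜ
    (B k · C k) ⟨ - 1# ⟩ *ᶜ 1/q
      *ᶜ (B k ⁻ · C k) ⟨ x k - 1# ⟩ *ᶜ C k ⁻ ⟨ x k ⟩
      *ᶜ A ⁻ ⟨ - x l ⟩ *ᶜ C l ⟨ - 1# ⟩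
      *ᶜ Fᴬ m A
           (removeAt (updateAt B l (λ Bl → Bl ⁻ · C l)) k)
           (removeAt C k)
           (removeAt (updateAt (λ i → - x i / x l) l (λ _ → 1#)) k)
    +ᶜ
    (B k · C k) ⟨ - 1# ⟩ *ᶜ 1/q
      *ᶜ ∑F≢ (x k ⁻¹) (λ tk →
           B k ⟨ tk ⟩ *ᶜ (B k ⁻ · C k) ⟨ 1# - tk ⟩ *ᶜ A ⁻ ⟨ 1# - x k * tk ⟩
           *ᶜ Fᴬ m A (removeAt B k) (removeAt C k)
                (removeAt (λ i → x i / (1# - x k * tk)) k))
theorem3p2 _ _ _ _ _ F _ _ A B C x k l k≢l xₗ≉0 xₖ≉0 =
  Fᴬ-reduction F A B C x k l k≢l xₗ≉0 xₖ≉0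
    -- `removeAt` is composition with `punchIn k`, so both pointwise hypotheses hold by reflexivity.
    (removeAt B k) (removeAt C k) (λ _ → ≡.refl) (λ _ → ≡.refl)
    {_} {_} {removeAt (updateAt B l _) k} {removeAt (updateAt (λ i → - x i / x l) l (λ _ → 1#)) k}
    (removeAt-updateAt-updates B k≢l) (removeAt-updateAt-minimal B k≢l)
    (removeAt-updateAt-updates (λ i → - x i / x l) k≢l)
    (removeAt-updateAt-minimal (λ i → - x i / x l) k≢l)
    (⟨⟩-product F (B k ⁻) (C k) λ _ → ℂᴿ.refl)
    (⟨⟩-product F (B l ⁻) (C l) λ _ → ℂᴿ.refl)
  where
  open Lauricella F
  module ℂᴿ = CommutativeRing ℂ-commutativeRing
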